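{- Let $u$ be a power of two, $r$ an integer with $1<r\le u/2$, and $p=2^b-1>u$ a Mersenne prime. Let $h:[u]\to[2^b-1]$ be a 4-universal hash function. For each key $x\in[u]$ set $h_x=h(x)+1$, $j_x=h_x\bmod 2^{b-1}$, $i_x=\lfloor rj_x/2^{b-1}\rfloor\in[r]$, $a_x=\lfloor h_x/2^{b-1}\rfloor$ and $s_x=1-2a_x\in\{ -1,1\}$. Let $f\in\mathbb Z^u$ be fixed, $n$ the number of $x$ with $f_x\neq0$, $F_m=\sum_{x\in[u]}f_x^m$, $C_t=\sum_{x\in[u]}s_xf_x[i_x=t]$ for $t\in[r]$, and $X=\sum_{t\in[r]}C_t^2$. Then $$\mathbb E[X]=F_2+(F_1^2-F_2)/p^2,\qquad |\mathbb E[X]-F_2|\le F_2(n-1)/p^2,\qquad \operatorname{Var}[X]<2\big(1+(r/2^b)^2\big)F_2^2/r.$$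
   Context: $[m]=\{0,\ldots,m-1\}$; $[P]$ is $1$ if $P$ holds and $0$ otherwise. A random hash function $h:U\to R$ is $k$-universal if for any $k$ distinct keys $x_0,\ldots,x_{k-1}\in U$, the tuple $(h(x_0),\ldots,h(x_{k-1}))$ is uniformly distributed on $R^k$. (The $C_t$ are the counters of the Count Sketch with bucket function $i$ and sign function $s$.)
   Formalization: The random hash function h is a uniform choice from a finite list of functions, so its probabilities are rational; the strict variance bound is stated only for f not identically zero, since for f = 0 both sides are 0 and it fails. -}

module Defs where

open import Data.Nat as ℕ using (ℕ; zero; suc; _^_; _∸_; _%_)
open import Data.Nat.DivMod using (_/_)
open import Data.Nat.Properties using (m^n>0)
open import Data.Integer as ℤ using (ℤ; +_)
open import Data.Rational as ℚ using (ℚ)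
open import Data.Fin as Fin using (Fin; toℕ)
open import Data.Bool using (Bool; true; false; if_then_else_; _∧_)
open import Relation.Nullary.Decidable using (⌊_⌋)
open import Function.Definitions using (Injective)
open import Relation.Binary.PropositionalEquality using (_≡_)

Σℤ : ∀ {n} → (Fin n → ℤ) → ℤ
Σℤ {zero}  g = + 0
Σℤ {suc n} g = g Fin.zero ℤ.+ Σℤ (λ i → g (Fin.suc i))

Σℚ : ∀ {n} → (Fin n → ℚ) → ℚ
Σℚ {zero}  g = ℚ.0ℚ
Σℚ {suc n} g = g Fin.zero ℚ.+ Σℚ (λ i → g (Fin.suc i))

count : ∀ {n} → (Fin n → Bool) → ℕ
count {zero}  g = 0
count {suc n} g = (if g Fin.zero then 1 else 0) ℕ.+ count (λ i → g (Fin.suc i))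

toℚ : ℤ → ℚ
toℚ z = z ℚ./ 1

-- A random hash function h : [u] → [p] is modelled as a uniformly chosen
-- member of a finite nonempty family  H : Fin (suc M) → (Fin u → Fin p).
Family : ℕ → ℕ → ℕ → Set
Family M u p = Fin (suc M) → Fin u → Fin p

agree4 : ∀ {u p} → (Fin u → Fin p) → (Fin 4 → Fin u) → (Fin 4 → Fin p) → Bool
agree4 h x v = ⌊ h (x Fin.zero) Fin.≟ v Fin.zero ⌋
             ∧ ⌊ h (x (Fin.suc Fin.zero)) Fin.≟ v (Fin.suc Fin.zero) ⌋
             ∧ ⌊ h (x (Fin.suc (Fin.suc Fin.zero))) Fin.≟ v (Fin.suc (Fin.suc Fin.zero)) ⌋
             ∧ ⌊ h (x (Fin.suc (Fin.suc (Fin.suc Fin.zero)))) Fin.≟ v (Fin.suc (Fin.suc (Fin.suc Fin.zero))) ⌋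

FourUniversal : ∀ {M u p} → Family M u p → Set
FourUniversal {M} {u} {p} H =
  (x : Fin 4 → Fin u) → Injective _≡_ _≡_ x → (v : Fin 4 → Fin p) →
  count (λ k → agree4 (H k) x v) ℕ.* p ^ 4 ≡ suc M

𝔼 : ∀ {M} → (Fin (suc M) → ℚ) → ℚ
𝔼 {M} Y = Σℚ Y ℚ.* (+ 1 ℚ./ suc M)

Var : ∀ {M} → (Fin (suc M) → ℚ) → ℚ
Var Y = 𝔼 (λ k → (Y k ℚ.- 𝔼 Y) ℚ.* (Y k ℚ.- 𝔼 Y))

module CountSketch (b r : ℕ) where
  half : ℕ
  half = 2 ^ (b ∸ 1)

  instance
    half-nz : ℕ.NonZero half
    half-nz = ℕ.>-nonZero (m^n>0 2 (b ∸ 1))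

  hx : ∀ {p} → Fin p → ℕ
  hx y = suc (toℕ y)

  jx : ∀ {p} → Fin p → ℕ
  jx y = hx y % half

  ix : ∀ {p} → Fin p → ℕ
  ix y = (r ℕ.* jx y) / half

  ax : ∀ {p} → Fin p → ℕ
  ax y = hx y / half

  sx : ∀ {p} → Fin p → ℤ
  sx y = + 1 ℤ.- (+ 2 ℤ.* + ax y)

  C : ∀ {u p} → (Fin u → Fin p) → (Fin u → ℤ) → Fin r → ℤ
  C h f t = Σℤ (λ x → if ⌊ ix (h x) ℕ.≟ toℕ t ⌋ then sx (h x) ℤ.* f x else + 0)

  X : ∀ {u p} → (Fin u → Fin p) → (Fin u → ℤ) → ℤ
  X h f = Σℤ (λ t → C h f t ℤ.* C h f t)

Fm : ∀ {u} → ℕ → (Fin u → ℤ) → ℤ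
Fm m f = Σℤ (λ x → f x ℤ.^ m)

nnz : ∀ {u} → (Fin u → ℤ) → ℕ
nnz f = count (λ x → if ⌊ f x ℤ.≟ + 0 ⌋ then false else true)

-- z / d in ℚ for a natural denominator (d = 0 is never used: all
-- denominators in the statement are provably positive)
_÷ℕ_ : ℚ → ℕ → ℚ
q ÷ℕ zero  = ℚ.0ℚ
q ÷ℕ suc d = q ℚ.* (+ 1 ℚ./ suc d)

{-# OPTIONS --safe #-}
-- With K(a,b) = Σ_t φ_t(a) φ_t(b), where φ_t(a) is the sign of the hash value a if its bucket is t and 0
-- otherwise, the estimator is X = F₂ + Y with Y = Σ_{x≠y} f_x f_y K(h_x,h_y).  The hash values 0, …, 2Q - 1
-- (2Q = 2^b) would be perfectly balanced in sign inside each bucket; omitting 0 leaves Σ_a φ_t(a) = -[t = 0].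
-- Hence Σ K(a,b) = 1, and 4-universality gives p² E[Y] = F₁² - F₂.  For the variance, p⁴ E[K(h_x,h_y) K(h_z,h_w)]
-- depends only on which keys coincide, and p⁴ E[Y]² cancels the part without coincidences, leaving
--   p⁴ Var[X] = 4 (c p - 1) W + 2 (S p² - 2 c p + 1) A,
-- where A = Σ_{x≠y} f_x² f_y², W = Σ_x f_x² (F₁ - f_x)², S = Σ K(a,b)² and c = Σ K(a,b) K(a,d).
-- Cauchy–Schwarz gives W ≤ (u - 1) A and u A ≤ (u - 1) F₂².  Every bucket receives ⌊Q/r⌋ or ⌊Q/r⌋ + 1 of the
-- residues mod Q, which bounds S, and the factor 1 - 1/u absorbs all lower order terms since 2u ≤ 2^b.
module Submission where

open import Defs
open import Data.Nat as ℕ using (ℕ; zero; suc; _^_; _∸_; _<_; _≤_; _%_; NonZero)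
import Data.Nat.Properties as ℕ
import Data.Nat.DivMod as ℕ
open import Data.Nat.DivMod using (_/_)
open import Data.Nat.Primality using (Prime)
open import Data.Integer as ℤ using (ℤ; +_; 0ℤ; 1ℤ; _+_; _*_; _-_; -_)
import Data.Integer.Properties as ℤ
open import Data.Integer.Tactic.RingSolver using (solve-∀)
open import Data.Rational as ℚ using (ℚ)
import Data.Rational.Properties as ℚ
open import Data.Rational.Unnormalised as ℚᵘ using (mkℚᵘ; *≡*; *≤*; *<*)
import Data.Rational.Unnormalised.Properties as ℚᵘ
open import Data.Fin as Fin using (Fin; toℕ; _≟_)
import Data.Fin.Properties as Fin
open import Data.Bool using (Bool; true; false; if_then_else_; _∧_)
open import Data.Product using (_×_; _,_; ∃; proj₁; proj₂)
open import Data.Empty using (⊥; ⊥-elim)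
open import Function using (_∘_)
open import Function.Definitions using (Injective)
open import Relation.Binary.Definitions using (tri<; tri≈; tri>)
open import Relation.Binary.PropositionalEquality
open import Relation.Nullary using (¬_; Dec; yes; no)
open import Relation.Nullary.Decidable using (⌊_⌋; ¬?)

-- The target leaves no room at leading order: with `q = 2^b`, the quantity `r S / p²` has to stay
-- near `1 + (r/q)²`, although only `p = q - 1` hash values exist and dividing by `p²` instead of
-- `q²` costs a relative `2/q`. The omitted value 0 pays for this. It removes `4 n₀ - 1` from `S`,
-- where `n₀` counts the residues in bucket 0, and bucket 0 begins exactly at a boundary, so
-- `r n₀ ≥ Q` without rounding loss. Hence `r S` is bounded with `q² - 2 q = p² - 1` in place of
-- `q²`. The remaining errors, from rounding in the buckets and from `W`, have relative order `1/q`,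
-- while `1 - 1/u` gains at least `2/q`.
--
-- 4-universality speaks only about four distinct keys. Expectations over two or three keys are
-- marginals and need spare keys, hence `4 ≤ u`, which comes from `2 ≤ r ≤ u/2`.
--
-- All identities are kept in the integers by multiplying through by the family size and powers of
-- `p`; fractions appear only at the end.

private variable
  m n : ℕ

-- Finite sums of integers

-- Opacity keeps the summand recoverable by unification.
opaque
  Σ : (Fin n → ℤ) → ℤ
  Σ = Σℤ

  Σ-def : (f : Fin n → ℤ) → Σℤ f ≡ Σ f
  Σ-def f = refl

  Σ-[] : (f : Fin 0 → ℤ) → Σ f ≡ 0ℤ
  Σ-[] f = refl

  Σ-∷ : (f : Fin (suc n) → ℤ) → Σ f ≡ f Fin.zero + Σ (λ i → f (Fin.suc i))
  Σ-∷ f = refl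

  Σ-cong : {f g : Fin n → ℤ} → (∀ i → f i ≡ g i) → Σ f ≡ Σ g
  Σ-cong {zero}  e = refl
  Σ-cong {suc n} e = cong₂ _+_ (e Fin.zero) (Σ-cong λ i → e (Fin.suc i))

  Σ-+ : (f g : Fin n → ℤ) → Σ (λ i → f i + g i) ≡ Σ f + Σ g
  Σ-+ {zero}  f g = refl
  Σ-+ {suc n} f g = trans (cong (_+_ (f Fin.zero + g Fin.zero)) (Σ-+ (λ i → f (Fin.suc i)) (λ i → g (Fin.suc i))))
    (interchange (f Fin.zero) (g Fin.zero) (Σ λ i → f (Fin.suc i)) (Σ λ i → g (Fin.suc i)))
    where
    interchange : ∀ a b c d → (a + b) + (c + d) ≡ (a + c) + (b + d)
    interchange = solve-∀

  Σ-*ˡ : (c : ℤ) (f : Fin n → ℤ) → Σ (λ i → c * f i) ≡ c * Σ f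
  Σ-*ˡ {zero}  c f = sym (ℤ.*-zeroʳ c)
  Σ-*ˡ {suc n} c f = trans (cong (_+_ (c * f Fin.zero)) (Σ-*ˡ c (λ i → f (Fin.suc i))))
    (sym (ℤ.*-distribˡ-+ c (f Fin.zero) (Σ λ i → f (Fin.suc i))))

  Σ-const : (n : ℕ) (c : ℤ) → Σ {n} (λ _ → c) ≡ + n * c
  Σ-const zero    c = refl
  Σ-const (suc n) c = trans (cong (_+_ c) (Σ-const n c)) (sym (ℤ.suc-* (+ n) c))

  Σ-mono : {f g : Fin n → ℤ} → (∀ i → f i ℤ.≤ g i) → Σ f ℤ.≤ Σ g
  Σ-mono {zero}  e = ℤ.≤-refl
  Σ-mono {suc n} e = ℤ.+-mono-≤ (e Fin.zero) (Σ-mono λ i → e (Fin.suc i))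

Σ-zero : {f : Fin n → ℤ} → (∀ i → f i ≡ 0ℤ) → Σ f ≡ 0ℤ
Σ-zero {n} e = trans (Σ-cong e) (trans (Σ-const n 0ℤ) (ℤ.*-zeroʳ (+ n)))

Σ-swap : (f : Fin m → Fin n → ℤ) → Σ (λ i → Σ (λ j → f i j)) ≡ Σ (λ j → Σ (λ i → f i j))
Σ-swap {zero}  f = trans (Σ-[] _) (sym (Σ-zero λ _ → Σ-[] _))
Σ-swap {suc m} f = begin
  Σ (λ i → Σ (f i))                                        ≡⟨ Σ-∷ _ ⟩
  Σ (f Fin.zero) + Σ (λ i → Σ (f (Fin.suc i)))             ≡⟨ cong (_+_ (Σ (f Fin.zero))) (Σ-swap λ i → f (Fin.suc i)) ⟩
  Σ (f Fin.zero) + Σ (λ j → Σ (λ i → f (Fin.suc i) j))     ≡⟨ Σ-+ (f Fin.zero) (λ j → Σ (λ i → f (Fin.suc i) j)) ⟨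
  Σ (λ j → f Fin.zero j + Σ (λ i → f (Fin.suc i) j))       ≡⟨ Σ-cong (λ j → sym (Σ-∷ (λ i → f i j))) ⟩
  Σ (λ j → Σ (λ i → f i j))                                ∎
  where open ≡-Reasoning

Σ-*ʳ : (f : Fin n → ℤ) (c : ℤ) → Σ (λ i → f i * c) ≡ Σ f * c
Σ-*ʳ f c = trans (Σ-cong λ i → ℤ.*-comm (f i) c) (trans (Σ-*ˡ c f) (ℤ.*-comm c (Σ f)))

Σ-lin : (a b : ℤ) (f g : Fin n → ℤ) → Σ (λ i → a * f i + b * g i) ≡ a * Σ f + b * Σ g
Σ-lin a b f g = trans (Σ-+ (λ i → a * f i) (λ i → b * g i)) (cong₂ _+_ (Σ-*ˡ a f) (Σ-*ˡ b g))

Σ-- : (f g : Fin n → ℤ) → Σ (λ i → f i - g i) ≡ Σ f - Σ g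
Σ-- f g = trans (Σ-cong λ i → minus (f i) (g i)) (trans (Σ-lin 1ℤ (- 1ℤ) f g) (sym (minus (Σ f) (Σ g))))
  where
  minus : ∀ a b → a - b ≡ 1ℤ * a + - 1ℤ * b
  minus = solve-∀

Σ-prod : (f : Fin m → ℤ) (g : Fin n → ℤ) → Σ (λ i → Σ (λ j → f i * g j)) ≡ Σ f * Σ g
Σ-prod f g = trans (Σ-cong λ i → Σ-*ˡ (f i) g) (Σ-*ʳ f (Σ g))

Σ-nonneg : {f : Fin n → ℤ} → (∀ i → 0ℤ ℤ.≤ f i) → 0ℤ ℤ.≤ Σ f
Σ-nonneg {n} e = ℤ.≤-trans (ℤ.≤-reflexive (sym (Σ-zero {n} λ _ → refl))) (Σ-mono e)

-- Indicators, Kronecker deltas and off-diagonal sums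

𝟙 : Bool → ℤ
𝟙 c = if c then 1ℤ else 0ℤ

opaque
  unfolding Σ

  Σ-𝟙 : (c : Fin n → Bool) → Σ (λ i → 𝟙 (c i)) ≡ + count c
  Σ-𝟙 {zero}  c = refl
  Σ-𝟙 {suc n} c with c Fin.zero
  ... | true  = cong (_+_ 1ℤ) (Σ-𝟙 λ i → c (Fin.suc i))
  ... | false = trans (ℤ.+-identityˡ (Σ λ i → 𝟙 (c (Fin.suc i)))) (Σ-𝟙 λ i → c (Fin.suc i))

𝟙-∧ : ∀ c d → 𝟙 (c ∧ d) ≡ 𝟙 c * 𝟙 d
𝟙-∧ true  true  = refl
𝟙-∧ true  false = refl
𝟙-∧ false d     = refl

δ : Fin n → Fin n → ℤ
δ i j = 𝟙 ⌊ i ≟ j ⌋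

δ-refl : (i : Fin n) → δ i i ≡ 1ℤ
δ-refl i with i ≟ i
... | yes _ = refl
... | no ne = ⊥-elim (ne refl)

δ-≢ : {i j : Fin n} → i ≢ j → δ i j ≡ 0ℤ
δ-≢ {i = i} {j} ne with i ≟ j
... | yes e = ⊥-elim (ne e)
... | no _  = refl

δ-comm : (i j : Fin n) → δ i j ≡ δ j i
δ-comm i j with i ≟ j
... | yes refl = sym (δ-refl i)
... | no ne    = sym (δ-≢ λ e → ne (sym e))

δ-suc : (i j : Fin n) → δ (Fin.suc i) (Fin.suc j) ≡ δ i j
δ-suc i j with i ≟ j
... | yes _ = refl
... | no _  = refl

Σ-δ : (i : Fin n) (f : Fin n → ℤ) → Σ (λ j → δ i j * f j) ≡ f i
Σ-δ Fin.zero f = begin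
  Σ (λ j → δ Fin.zero j * f j) ≡⟨ Σ-∷ _ ⟩
  1ℤ * f Fin.zero + Σ (λ j → 0ℤ * f (Fin.suc j)) ≡⟨ cong₂ _+_ (ℤ.*-identityˡ (f Fin.zero)) (Σ-zero λ _ → refl) ⟩
  f Fin.zero + 0ℤ                                ≡⟨ ℤ.+-identityʳ (f Fin.zero) ⟩
  f Fin.zero ∎
  where open ≡-Reasoning
Σ-δ (Fin.suc i) f = begin
  Σ (λ j → δ (Fin.suc i) j * f j)                              ≡⟨ Σ-∷ _ ⟩
  0ℤ + Σ (λ j → δ (Fin.suc i) (Fin.suc j) * f (Fin.suc j))     ≡⟨ ℤ.+-identityˡ _ ⟩
  Σ (λ j → δ (Fin.suc i) (Fin.suc j) * f (Fin.suc j))          ≡⟨ Σ-cong (λ j → cong (_* f (Fin.suc j)) (δ-suc i j)) ⟩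
  Σ (λ j → δ i j * f (Fin.suc j))                              ≡⟨ Σ-δ i (λ j → f (Fin.suc j)) ⟩
  f (Fin.suc i) ∎
  where open ≡-Reasoning

off : Fin n → Fin n → ℤ
off i j = 1ℤ - δ i j

off-refl : (i : Fin n) → off i i ≡ 0ℤ
off-refl i = cong (_-_ 1ℤ) (δ-refl i)

off-comm : (i j : Fin n) → off i j ≡ off j i
off-comm i j = cong (_-_ 1ℤ) (δ-comm i j)

off-idem : (i j : Fin n) → off i j * off i j ≡ off i j
off-idem i j with i ≟ j
... | yes _ = refl
... | no _  = refl

off-nonneg : (i j : Fin n) → 0ℤ ℤ.≤ off i j
off-nonneg i j with i ≟ j
... | yes _ = ℤ.≤-refl
... | no _  = ℤ.+≤+ ℕ.z≤n

Σ-off : (i : Fin n) (f : Fin n → ℤ) → Σ (λ j → off i j * f j) ≡ Σ f - f i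
Σ-off i f = begin
  Σ (λ j → off i j * f j)            ≡⟨ Σ-cong (λ j → distrib (δ i j) (f j)) ⟩
  Σ (λ j → f j - δ i j * f j)        ≡⟨ Σ-- f _ ⟩
  Σ f - Σ (λ j → δ i j * f j)       ≡⟨ cong (_-_ (Σ f)) (Σ-δ i f) ⟩
  Σ f - f i                          ∎
  where
  open ≡-Reasoning
  distrib : ∀ d a → (1ℤ - d) * a ≡ a - d * a
  distrib = solve-∀

-- Positivity and Cauchy-Schwarz

*-nonneg : ∀ {a b} → 0ℤ ℤ.≤ a → 0ℤ ℤ.≤ b → 0ℤ ℤ.≤ a * b
*-nonneg {+ m} {+ n} _ _ = subst (0ℤ ℤ.≤_) (ℤ.pos-* m n) (ℤ.+≤+ ℕ.z≤n)

+-nonneg : ∀ {a b} → 0ℤ ℤ.≤ a → 0ℤ ℤ.≤ b → 0ℤ ℤ.≤ a + b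
+-nonneg = ℤ.+-mono-≤

square-nonneg : ∀ a → 0ℤ ℤ.≤ a * a
square-nonneg (+ n)      = *-nonneg {+ n} {+ n} (ℤ.+≤+ ℕ.z≤n) (ℤ.+≤+ ℕ.z≤n)
square-nonneg ℤ.-[1+ n ] = ℤ.+≤+ ℕ.z≤n

≤-from-nonneg : ∀ {a b d} → b - a ≡ d → 0ℤ ℤ.≤ d → a ℤ.≤ b
≤-from-nonneg e d≥0 = ℤ.0≤i-j⇒j≤i (subst (0ℤ ℤ.≤_) (sym e) d≥0)

-- The case ε = -1 is Cauchy–Schwarz; both signs are needed for the two-sided bound on F₁² - F₂.
Σ-pair-square : (w g : Fin n → ℤ) (ε : ℤ) → ε * ε ≡ 1ℤ →
  Σ (λ x → Σ (λ y → (w x * w y) * ((g x + ε * g y) * (g x + ε * g y))))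
  ≡ + 2 * (Σ w * Σ (λ x → w x * (g x * g x)) + ε * (Σ (λ x → w x * g x) * Σ (λ x → w x * g x)))
Σ-pair-square w g ε ε² = begin
  Σ (λ x → Σ (λ y → (w x * w y) * ((g x + ε * g y) * (g x + ε * g y))))
    ≡⟨ Σ-cong (λ x → trans (Σ-cong λ y → expand (w x) (w y) (g x) (g y))
         (trans (Σ-+ (λ y → P x * w y + w x * P y) (λ y → + 2 * ε * L x * L y))
           (cong₂ _+_ (Σ-lin (P x) (w x) w P) (Σ-*ˡ (+ 2 * ε * L x) L)))) ⟩
  Σ (λ x → P x * Σ w + w x * Σ P + + 2 * ε * L x * Σ L)
    ≡⟨ Σ-cong (λ x → commute (P x) (Σ w) (w x) (Σ P) ε (L x) (Σ L)) ⟩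
  Σ (λ x → Σ w * P x + Σ P * w x + + 2 * ε * Σ L * L x)
    ≡⟨ trans (Σ-+ (λ x → Σ w * P x + Σ P * w x) (λ x → + 2 * ε * Σ L * L x))
         (cong₂ _+_ (Σ-lin (Σ w) (Σ P) P w) (Σ-*ˡ (+ 2 * ε * Σ L) L)) ⟩
  Σ w * Σ P + Σ P * Σ w + + 2 * ε * Σ L * Σ L
    ≡⟨ collect (Σ P) (Σ w) ε (Σ L) ⟩
  + 2 * (Σ w * Σ P + ε * (Σ L * Σ L)) ∎
  where
  open ≡-Reasoning
  P L : Fin _ → ℤ
  P x = w x * (g x * g x)
  L x = w x * g x
  poly : ∀ a b c d e → (a * b) * ((c + e * d) * (c + e * d))
    ≡ a * (c * c) * b + (e * e) * (a * (b * (d * d))) + + 2 * e * (a * c) * (b * d)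
  poly = solve-∀
  expand : ∀ a b c d → (a * b) * ((c + ε * d) * (c + ε * d))
    ≡ a * (c * c) * b + a * (b * (d * d)) + + 2 * ε * (a * c) * (b * d)
  expand a b c d = trans (poly a b c d ε) (cong (λ e → a * (c * c) * b + e + + 2 * ε * (a * c) * (b * d))
    (trans (cong (_* (a * (b * (d * d)))) ε²) (ℤ.*-identityˡ (a * (b * (d * d))))))
  commute : ∀ p s w t e l m → p * s + w * t + + 2 * e * l * m ≡ s * p + t * w + + 2 * e * m * l
  commute = solve-∀
  collect : ∀ P w e L → w * P + P * w + + 2 * e * L * L ≡ + 2 * (w * P + e * (L * L))
  collect = solve-∀

half-nonneg : ∀ {a} → 0ℤ ℤ.≤ + 2 * a → 0ℤ ℤ.≤ a
half-nonneg {+ n}        _ = ℤ.+≤+ ℕ.z≤n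
half-nonneg {ℤ.-[1+ n ]} ()

cauchy : (w g : Fin n → ℤ) → (∀ x → 0ℤ ℤ.≤ w x) →
  Σ (λ x → w x * g x) * Σ (λ x → w x * g x) ℤ.≤ Σ w * Σ (λ x → w x * (g x * g x))
cauchy w g w≥0 = ≤-from-nonneg (minus (Σ w * Σ (λ x → w x * (g x * g x))) (Σ (λ x → w x * g x) * Σ (λ x → w x * g x))) (half-nonneg (subst (0ℤ ℤ.≤_) (Σ-pair-square w g (- 1ℤ) refl)
  (Σ-nonneg λ x → Σ-nonneg λ y → *-nonneg (*-nonneg (w≥0 x) (w≥0 y)) (square-nonneg (g x + - 1ℤ * g y)))))
  where
  minus : ∀ a b → a - b ≡ a + - 1ℤ * b
  minus = solve-∀

-- Expectations over a 4-universal family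

Σ⁴ : (Fin n → Fin n → Fin n → Fin n → ℤ) → ℤ
Σ⁴ G = Σ λ a → Σ λ b → Σ λ c → Σ λ d → G a b c d

Σ⁴-cong : {F G : Fin n → Fin n → Fin n → Fin n → ℤ} → (∀ a b c d → F a b c d ≡ G a b c d) → Σ⁴ F ≡ Σ⁴ G
Σ⁴-cong e = Σ-cong λ a → Σ-cong λ b → Σ-cong λ c → Σ-cong λ d → e a b c d

Σ⁴-*ˡ : (s : ℤ) (G : Fin n → Fin n → Fin n → Fin n → ℤ) → Σ⁴ (λ a b c d → s * G a b c d) ≡ s * Σ⁴ G
Σ⁴-*ˡ s G = trans (Σ-cong λ a → trans (Σ-cong λ b → trans (Σ-cong λ c → Σ-*ˡ s (G a b c))
  (Σ-*ˡ s λ c → Σ (G a b c))) (Σ-*ˡ s λ b → Σ λ c → Σ (G a b c))) (Σ-*ˡ s λ a → Σ λ b → Σ λ c → Σ (G a b c))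

Σ-Σ⁴-swap : (G : Fin m → Fin n → Fin n → Fin n → Fin n → ℤ) →
  Σ (λ k → Σ⁴ (G k)) ≡ Σ⁴ (λ a b c d → Σ λ k → G k a b c d)
Σ-Σ⁴-swap G =
  trans (Σ-swap λ k a → Σ λ b → Σ λ c → Σ λ d → G k a b c d) (Σ-cong λ a →
  trans (Σ-swap λ k b → Σ λ c → Σ λ d → G k a b c d) (Σ-cong λ b →
  trans (Σ-swap λ k c → Σ λ d → G k a b c d) (Σ-cong λ c →
  Σ-swap λ k d → G k a b c d)))

Σ⁴-δ : (a b c d : Fin n) (G : Fin n → Fin n → Fin n → Fin n → ℤ) →
  Σ⁴ (λ a′ b′ c′ d′ → (δ a a′ * (δ b b′ * (δ c c′ * δ d d′))) * G a′ b′ c′ d′) ≡ G a b c d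
Σ⁴-δ a b c d G =
  trans (Σ-cong λ a′ → trans (Σ-cong λ b′ → trans (Σ-cong λ c′ →
      trans (Σ-cong λ d′ → assoc (δ a a′) (δ b b′) (δ c c′) (δ d d′) (G a′ b′ c′ d′))
      (trans (Σ-*ˡ (δ a a′ * (δ b b′ * δ c c′)) _) (trans (cong (δ a a′ * (δ b b′ * δ c c′) *_) (Σ-δ d (G a′ b′ c′)))
        (assoc₃ (δ a a′) (δ b b′) (δ c c′) (G a′ b′ c′ d)))))
    (trans (Σ-*ˡ (δ a a′ * δ b b′) _) (trans (cong (δ a a′ * δ b b′ *_) (Σ-δ c (λ c′ → G a′ b′ c′ d)))
      (ℤ.*-assoc (δ a a′) (δ b b′) (G a′ b′ c d)))))
   (trans (Σ-*ˡ (δ a a′) _) (cong (δ a a′ *_) (Σ-δ b (λ b′ → G a′ b′ c d)))))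
  (Σ-δ a (λ a′ → G a′ b c d))
  where
  assoc : ∀ a b c d g → (a * (b * (c * d))) * g ≡ (a * (b * c)) * (d * g)
  assoc = solve-∀
  assoc₃ : ∀ a b c g → (a * (b * c)) * g ≡ (a * b) * (c * g)
  assoc₃ = solve-∀

⟨_,_,_,_⟩ : {A : Set} → A → A → A → A → Fin 4 → A
⟨ a , b , c , d ⟩ Fin.zero                                = a
⟨ a , b , c , d ⟩ (Fin.suc Fin.zero)                      = b
⟨ a , b , c , d ⟩ (Fin.suc (Fin.suc Fin.zero))            = c
⟨ a , b , c , d ⟩ (Fin.suc (Fin.suc (Fin.suc Fin.zero)))  = d

fresh : m < n → (v : Fin m → Fin n) → ∃ λ z → ∀ i → v i ≢ z
fresh {m} {n} m<n v with Fin.any? (λ z → Fin.all? λ i → ¬? (v i ≟ z))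
... | yes z   = z
... | no none = ⊥-elim (ℕ.<⇒≢ i<j (cong toℕ (trans (sym (proj₂ (preimage i))) (trans (cong v same) (proj₂ (preimage j))))))
  where
  preimage : ∀ z → ∃ λ i → v i ≡ z
  preimage z with Fin.any? (λ i → v i ≟ z)
  ... | yes e = e
  ... | no ne = ⊥-elim (none (z , λ i e → ne (i , e)))
  collision = Fin.pigeonhole m<n (proj₁ ∘ preimage)
  i = proj₁ collision
  j = proj₁ (proj₂ collision)
  i<j = proj₁ (proj₂ (proj₂ collision))
  same = proj₂ (proj₂ (proj₂ collision))

module Universality {M u p : ℕ} (H : Family M u (suc p)) (univ : FourUniversal H) (4≤u : 4 ≤ u) where

  P N : ℤ
  P = + suc p
  N = + suc M

  -- Writing `G` at the hash values as a delta-weighted sum over all quadruples and exchanging sums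
  -- leaves, for each quadruple, the number of functions that hit it. That number is `N / P⁴`
  -- whatever the quadruple.
  expectation₄ : ∀ {x y z w} → x ≢ y → x ≢ z → x ≢ w → y ≢ z → y ≢ w → z ≢ w →
    (G : Fin (suc p) → Fin (suc p) → Fin (suc p) → Fin (suc p) → ℤ) →
    P * P * P * P * Σ (λ k → G (H k x) (H k y) (H k z) (H k w)) ≡ N * Σ⁴ G
  expectation₄ {x} {y} {z} {w} xy xz xw yz yw zw G = begin
    P * P * P * P * Σ (λ k → G (H k x) (H k y) (H k z) (H k w))
      ≡⟨ cong (P * P * P * P *_) (Σ-cong λ k → sym (Σ⁴-δ (H k x) (H k y) (H k z) (H k w) G)) ⟩
    P * P * P * P * Σ (λ k → Σ⁴ λ a b c d → hit k a b c d * G a b c d)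
      ≡⟨ cong (P * P * P * P *_) (Σ-Σ⁴-swap λ k a b c d → hit k a b c d * G a b c d) ⟩
    P * P * P * P * Σ⁴ (λ a b c d → Σ λ k → hit k a b c d * G a b c d)
      ≡⟨ Σ⁴-*ˡ (P * P * P * P) (λ a b c d → Σ λ k → hit k a b c d * G a b c d) ⟨
    Σ⁴ (λ a b c d → P * P * P * P * Σ λ k → hit k a b c d * G a b c d)
      ≡⟨ Σ⁴-cong (λ a b c d → trans (cong (P * P * P * P *_) (Σ-*ʳ (λ k → hit k a b c d) (G a b c d)))
           (trans (sym (ℤ.*-assoc (P * P * P * P) (Σ λ k → hit k a b c d) (G a b c d))) (cong (_* G a b c d) (uniform a b c d)))) ⟩
    Σ⁴ (λ a b c d → N * G a b c d)
      ≡⟨ Σ⁴-*ˡ N G ⟩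
    N * Σ⁴ G ∎
    where
    open ≡-Reasoning
    hit : Fin (suc M) → Fin (suc p) → Fin (suc p) → Fin (suc p) → Fin (suc p) → ℤ
    hit k a b c d = δ (H k x) a * (δ (H k y) b * (δ (H k z) c * δ (H k w) d))

    distinct : Injective _≡_ _≡_ ⟨ x , y , z , w ⟩
    distinct {Fin.zero} {Fin.zero} e = refl
    distinct {Fin.zero} {Fin.suc Fin.zero} e = ⊥-elim (xy e)
    distinct {Fin.zero} {Fin.suc (Fin.suc Fin.zero)} e = ⊥-elim (xz e)
    distinct {Fin.zero} {Fin.suc (Fin.suc (Fin.suc Fin.zero))} e = ⊥-elim (xw e)
    distinct {Fin.suc Fin.zero} {Fin.zero} e = ⊥-elim (xy (sym e))
    distinct {Fin.suc Fin.zero} {Fin.suc Fin.zero} e = refl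
    distinct {Fin.suc Fin.zero} {Fin.suc (Fin.suc Fin.zero)} e = ⊥-elim (yz e)
    distinct {Fin.suc Fin.zero} {Fin.suc (Fin.suc (Fin.suc Fin.zero))} e = ⊥-elim (yw e)
    distinct {Fin.suc (Fin.suc Fin.zero)} {Fin.zero} e = ⊥-elim (xz (sym e))
    distinct {Fin.suc (Fin.suc Fin.zero)} {Fin.suc Fin.zero} e = ⊥-elim (yz (sym e))
    distinct {Fin.suc (Fin.suc Fin.zero)} {Fin.suc (Fin.suc Fin.zero)} e = refl
    distinct {Fin.suc (Fin.suc Fin.zero)} {Fin.suc (Fin.suc (Fin.suc Fin.zero))} e = ⊥-elim (zw e)
    distinct {Fin.suc (Fin.suc (Fin.suc Fin.zero))} {Fin.zero} e = ⊥-elim (xw (sym e))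
    distinct {Fin.suc (Fin.suc (Fin.suc Fin.zero))} {Fin.suc Fin.zero} e = ⊥-elim (yw (sym e))
    distinct {Fin.suc (Fin.suc (Fin.suc Fin.zero))} {Fin.suc (Fin.suc Fin.zero)} e = ⊥-elim (zw (sym e))
    distinct {Fin.suc (Fin.suc (Fin.suc Fin.zero))} {Fin.suc (Fin.suc (Fin.suc Fin.zero))} e = refl

    fourth-power : + (suc p ^ 4) ≡ P * P * P * P
    fourth-power = trans (cong +_ (nat (suc p)))
      (trans (ℤ.pos-* (suc p ℕ.* suc p ℕ.* suc p) (suc p)) (cong (_* P)
      (trans (ℤ.pos-* (suc p ℕ.* suc p) (suc p)) (cong (_* P) (ℤ.pos-* (suc p) (suc p))))))
      where
      nat : ∀ q → q ^ 4 ≡ q ℕ.* q ℕ.* q ℕ.* q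
      nat q = trans (cong (λ e → q ℕ.* (q ℕ.* (q ℕ.* e))) (ℕ.*-identityʳ q))
        (trans (cong (q ℕ.*_) (sym (ℕ.*-assoc q q q))) (trans (sym (ℕ.*-assoc q (q ℕ.* q) q)) (cong (ℕ._* q) (sym (ℕ.*-assoc q q q)))))

    uniform : ∀ a b c d → P * P * P * P * Σ (λ k → hit k a b c d) ≡ N
    uniform a b c d = begin
      P * P * P * P * Σ (λ k → hit k a b c d)
        ≡⟨ cong₂ _*_ (sym fourth-power) (Σ-cong λ k → sym (indicator k)) ⟩
      + (suc p ^ 4) * Σ (λ k → 𝟙 (agree4 (H k) ⟨ x , y , z , w ⟩ ⟨ a , b , c , d ⟩))
        ≡⟨ cong (+ (suc p ^ 4) *_) (Σ-𝟙 λ k → agree4 (H k) ⟨ x , y , z , w ⟩ ⟨ a , b , c , d ⟩) ⟩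
      + (suc p ^ 4) * + total
        ≡⟨ trans (ℤ.*-comm (+ (suc p ^ 4)) (+ total)) (sym (ℤ.pos-* total (suc p ^ 4))) ⟩
      + (total ℕ.* suc p ^ 4)
        ≡⟨ cong +_ (univ ⟨ x , y , z , w ⟩ distinct ⟨ a , b , c , d ⟩) ⟩
      N ∎
      where
      total : ℕ
      total = count (λ k → agree4 (H k) ⟨ x , y , z , w ⟩ ⟨ a , b , c , d ⟩)
      indicator : ∀ k → 𝟙 (agree4 (H k) ⟨ x , y , z , w ⟩ ⟨ a , b , c , d ⟩) ≡ hit k a b c d
      indicator k = trans (𝟙-∧ ⌊ H k x ≟ a ⌋ _) (cong (δ (H k x) a *_)
        (trans (𝟙-∧ ⌊ H k y ≟ b ⌋ _) (cong (δ (H k y) b *_) (𝟙-∧ ⌊ H k z ≟ c ⌋ ⌊ H k w ≟ d ⌋))))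

  expectation₃ : ∀ {x y z} → x ≢ y → x ≢ z → y ≢ z → (G : Fin (suc p) → Fin (suc p) → Fin (suc p) → ℤ) →
    P * P * P * Σ (λ k → G (H k x) (H k y) (H k z)) ≡ N * Σ (λ a → Σ λ b → Σ λ c → G a b c)
  expectation₃ {x} {y} {z} xy xz yz G = ℤ.*-cancelˡ-≡ P _ _ (begin
    P * (P * P * P * S)                               ≡⟨ rotate P S ⟩
    P * P * P * P * S                                 ≡⟨ expectation₄ xy xz (new Fin.zero) yz (new (Fin.suc Fin.zero)) (new (Fin.suc (Fin.suc Fin.zero))) (λ a b c d → G a b c) ⟩
    N * Σ⁴ (λ a b c d → G a b c)                      ≡⟨ cong (N *_) (Σ-cong λ a → Σ-cong λ b → Σ-cong λ c → Σ-const (suc p) (G a b c)) ⟩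
    N * Σ (λ a → Σ λ b → Σ λ c → P * G a b c)         ≡⟨ cong (N *_) (trans (Σ-cong λ a → trans (Σ-cong λ b → Σ-*ˡ P (G a b)) (Σ-*ˡ P λ b → Σ (G a b))) (Σ-*ˡ P λ a → Σ λ b → Σ (G a b))) ⟩
    N * (P * T)                                       ≡⟨ exchange N P T ⟩
    P * (N * T)                                       ∎)
    where
    open ≡-Reasoning
    -- `inject₁` reaches only the first three entries; the repeated `z` is padding.
    v : Fin 3 → Fin u
    v i = ⟨ x , y , z , z ⟩ (Fin.inject₁ i)
    new = proj₂ (fresh 4≤u v)
    S T : ℤ
    S = Σ (λ k → G (H k x) (H k y) (H k z))
    T = Σ (λ a → Σ λ b → Σ λ c → G a b c)
    rotate : ∀ P S → P * (P * P * P * S) ≡ P * P * P * P * S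
    rotate = solve-∀
    exchange : ∀ N P T → N * (P * T) ≡ P * (N * T)
    exchange = solve-∀

  expectation₂ : ∀ {x y} → x ≢ y → (G : Fin (suc p) → Fin (suc p) → ℤ) →
    P * P * Σ (λ k → G (H k x) (H k y)) ≡ N * Σ (λ a → Σ λ b → G a b)
  expectation₂ {x} {y} xy G = ℤ.*-cancelˡ-≡ P _ _ (begin
    P * (P * P * S)                         ≡⟨ rotate P S ⟩
    P * P * P * S                           ≡⟨ expectation₃ xy (new Fin.zero) (new (Fin.suc Fin.zero)) (λ a b c → G a b) ⟩
    N * Σ (λ a → Σ λ b → Σ λ c → G a b)     ≡⟨ cong (N *_) (Σ-cong λ a → Σ-cong λ b → Σ-const (suc p) (G a b)) ⟩
    N * Σ (λ a → Σ λ b → P * G a b)         ≡⟨ cong (N *_) (trans (Σ-cong λ a → Σ-*ˡ P (G a)) (Σ-*ˡ P λ a → Σ (G a))) ⟩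
    N * (P * T)                             ≡⟨ exchange N P T ⟩
    P * (N * T)                             ∎)
    where
    open ≡-Reasoning
    v : Fin 2 → Fin u
    v i = ⟨ x , y , y , y ⟩ (Fin.inject₁ (Fin.inject₁ i))
    new = proj₂ (fresh (ℕ.<-trans (ℕ.n<1+n 2) 4≤u) v)
    S T : ℤ
    S = Σ (λ k → G (H k x) (H k y))
    T = Σ (λ a → Σ λ b → G a b)
    rotate : ∀ P S → P * (P * P * S) ≡ P * P * P * S
    rotate = solve-∀
    exchange : ∀ N P T → N * (P * T) ≡ P * (N * T)
    exchange = solve-∀

-- Moments of a quadratic form in the hash values

Σ² : (Fin m → Fin n → ℤ) → ℤ
Σ² F = Σ λ x → Σ λ y → F x y

Σ²-cong : {F G : Fin m → Fin n → ℤ} → (∀ x y → F x y ≡ G x y) → Σ² F ≡ Σ² G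
Σ²-cong e = Σ-cong λ x → Σ-cong λ y → e x y

Σ²-+ : (F G : Fin m → Fin n → ℤ) → Σ² (λ x y → F x y + G x y) ≡ Σ² F + Σ² G
Σ²-+ F G = trans (Σ-cong λ x → Σ-+ (F x) (G x)) (Σ-+ (λ x → Σ (F x)) (λ x → Σ (G x)))

Σ²-*ˡ : (c : ℤ) (F : Fin m → Fin n → ℤ) → Σ² (λ x y → c * F x y) ≡ c * Σ² F
Σ²-*ˡ c F = trans (Σ-cong λ x → Σ-*ˡ c (F x)) (Σ-*ˡ c λ x → Σ (F x))

Σ²-*ʳ : (F : Fin m → Fin n → ℤ) (c : ℤ) → Σ² (λ x y → F x y * c) ≡ Σ² F * c
Σ²-*ʳ F c = trans (Σ-cong λ x → Σ-*ʳ (F x) c) (Σ-*ʳ (λ x → Σ (F x)) c)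

Σ²-square : (F : Fin n → Fin n → ℤ) → Σ² F * Σ² F ≡ Σ⁴ (λ x y z w → F x y * F z w)
Σ²-square F = sym (trans (Σ²-cong λ x y → Σ²-*ˡ (F x y) F) (Σ²-*ʳ F (Σ² F)))

module PairForm {u : ℕ} (G : Fin u → Fin u → ℤ) (G-sym : ∀ x y → G x y ≡ G y x) where

  T W A : ℤ
  R : Fin u → ℤ
  T = Σ² G
  R x = Σ (G x)
  W = Σ λ x → R x * R x
  A = Σ² λ x y → G x y * G x y

  row : ∀ x → Σ² (λ z w → δ x z * G z w) ≡ R x
  row x = trans (Σ-cong λ z → Σ-*ˡ (δ x z) (G z)) (Σ-δ x R)

  column : ∀ x → Σ² (λ z w → δ x w * G z w) ≡ R x
  column x = trans (Σ-swap λ z w → δ x w * G z w) (trans (Σ²-cong λ w z → cong (δ x w *_) (G-sym z w)) (row x))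

  entry : ∀ x y → Σ² (λ z w → (δ x z * δ y w) * G z w) ≡ G x y
  entry x y = trans (Σ-cong λ z → trans (Σ-cong λ w → ℤ.*-assoc (δ x z) (δ y w) (G z w))
    (trans (Σ-*ˡ (δ x z) (λ w → δ y w * G z w)) (cong (δ x z *_) (Σ-δ y (G z))))) (Σ-δ x λ z → G z y)

  -- p⁴ E[K(h x, h y) K(h z, h w)] for x ≢ y and z ≢ w, interpolating between the three cases of
  -- zero, one or two shared keys.
  sharing : ℤ → ℤ → Fin u → Fin u → Fin u → Fin u → ℤ
  sharing α β x y z w = 1ℤ + α * (δ x z + δ x w + (δ y z + δ y w)) + β * (δ x z * δ y w + δ y z * δ x w)

  inner-sharing : ∀ α β x y →
    Σ² (λ z w → G z w * sharing α β x y z w) ≡ T + α * (+ 2 * R x + + 2 * R y) + β * (+ 2 * G x y)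
  inner-sharing α β x y = begin
    Σ² (λ z w → G z w * sharing α β x y z w)
      ≡⟨ Σ²-cong (λ z w → expand (G z w) α β (δ x z) (δ x w) (δ y z) (δ y w)) ⟩
    Σ² (λ z w → G z w + α * (E₁ z w + E₂ z w + (E₃ z w + E₄ z w)) + β * (D₁ z w + D₂ z w))
      ≡⟨ trans (Σ²-+ _ (λ z w → β * (D₁ z w + D₂ z w))) (cong₂ _+_
          (trans (Σ²-+ G _) (cong (_+_ T) (trans (Σ²-*ˡ α _) (cong (α *_)
             (trans (Σ²-+ _ (λ z w → E₃ z w + E₄ z w)) (cong₂ _+_ (trans (Σ²-+ E₁ E₂) (cong₂ _+_ (row x) (column x)))
               (trans (Σ²-+ E₃ E₄) (cong₂ _+_ (row y) (column y)))))))))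
          (trans (Σ²-*ˡ β _) (cong (β *_) (trans (Σ²-+ D₁ D₂) (cong₂ _+_ (entry x y) (trans (entry y x) (G-sym y x))))))) ⟩
    T + α * (R x + R x + (R y + R y)) + β * (G x y + G x y)
      ≡⟨ collect T α β (R x) (R y) (G x y) ⟩
    T + α * (+ 2 * R x + + 2 * R y) + β * (+ 2 * G x y) ∎
    where
    open ≡-Reasoning
    E₁ E₂ E₃ E₄ D₁ D₂ : Fin u → Fin u → ℤ
    E₁ z w = δ x z * G z w
    E₂ z w = δ x w * G z w
    E₃ z w = δ y z * G z w
    E₄ z w = δ y w * G z w
    D₁ z w = (δ x z * δ y w) * G z w
    D₂ z w = (δ y z * δ x w) * G z w
    expand : ∀ g α β a b c d → g * (1ℤ + α * (a + b + (c + d)) + β * (a * d + c * b))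
      ≡ g + α * (a * g + b * g + (c * g + d * g)) + β * ((a * d) * g + (c * b) * g)
    expand = solve-∀
    collect : ∀ t α β r s g → t + α * (r + r + (s + s)) + β * (g + g) ≡ t + α * (+ 2 * r + + 2 * s) + β * (+ 2 * g)
    collect = solve-∀

  -- One key can be shared in four ways, each summing to `W`; both keys can be shared in two ways,
  -- each summing to `A`. Symmetry of `G` makes the ways interchangeable.
  total-sharing : ∀ α β →
    Σ⁴ (λ x y z w → (G x y * G z w) * sharing α β x y z w) ≡ T * T + + 4 * α * W + + 2 * β * A
  total-sharing α β = begin
    Σ⁴ (λ x y z w → (G x y * G z w) * sharing α β x y z w)
      ≡⟨ Σ²-cong (λ x y → trans (Σ²-cong λ z w → ℤ.*-assoc (G x y) (G z w) (sharing α β x y z w))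
           (trans (Σ²-*ˡ (G x y) λ z w → G z w * sharing α β x y z w) (cong (G x y *_) (inner-sharing α β x y)))) ⟩
    Σ² (λ x y → G x y * (T + α * (+ 2 * R x + + 2 * R y) + β * (+ 2 * G x y)))
      ≡⟨ Σ²-cong (λ x y → expand (G x y) T α β (R x) (R y)) ⟩
    Σ² (λ x y → T * G x y + + 2 * α * (G x y * R x + G x y * R y) + + 2 * β * (G x y * G x y))
      ≡⟨ trans (Σ²-+ _ _) (cong₂ _+_ (trans (Σ²-+ _ _) (cong₂ _+_ (Σ²-*ˡ T G)
           (trans (Σ²-*ˡ (+ 2 * α) _) (cong (+ 2 * α *_) (trans (Σ²-+ (λ x y → G x y * R x) (λ x y → G x y * R y)) (cong₂ _+_ row-square column-square))))))
           (Σ²-*ˡ (+ 2 * β) λ x y → G x y * G x y)) ⟩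
    T * T + + 2 * α * (W + W) + + 2 * β * A
      ≡⟨ collect T α β W A ⟩
    T * T + + 4 * α * W + + 2 * β * A ∎
    where
    open ≡-Reasoning
    row-square : Σ² (λ x y → G x y * R x) ≡ W
    row-square = Σ-cong λ x → Σ-*ʳ (G x) (R x)
    column-square : Σ² (λ x y → G x y * R y) ≡ W
    column-square = trans (Σ-swap λ x y → G x y * R y) (trans (Σ²-cong λ y x → cong (_* R y) (G-sym x y)) row-square)
    expand : ∀ g t α β r s → g * (t + α * (+ 2 * r + + 2 * s) + β * (+ 2 * g))
      ≡ t * g + + 2 * α * (g * r + g * s) + + 2 * β * (g * g)
    expand = solve-∀
    collect : ∀ t α β w a → t * t + + 2 * α * (w + w) + + 2 * β * a ≡ t * t + + 4 * α * w + + 2 * β * a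
    collect = solve-∀

-- Off-diagonal weights and their Cauchy-Schwarz bounds

module OffDiagonal {u : ℕ} (f : Fin u → ℤ) where

  F₁ F₂ : ℤ
  F₁ = Σ f
  F₂ = Σ λ x → f x * f x

  G : Fin u → Fin u → ℤ
  G x y = off x y * (f x * f y)

  G-sym : ∀ x y → G x y ≡ G y x
  G-sym x y = cong₂ _*_ (off-comm x y) (ℤ.*-comm (f x) (f y))

  open PairForm G G-sym public

  G-row : ∀ x → R x ≡ f x * Σ (λ y → off x y * f y)
  G-row x = trans (Σ-cong λ y → swap (off x y) (f x) (f y)) (Σ-*ˡ (f x) λ y → off x y * f y)
    where
    swap : ∀ o a b → o * (a * b) ≡ a * (o * b)
    swap = solve-∀

  T-value : T ≡ F₁ * F₁ - F₂
  T-value = begin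
    Σ R                                ≡⟨ Σ-cong (λ x → trans (G-row x) (trans (cong (f x *_) (Σ-off x f)) (distrib (f x) F₁))) ⟩
    Σ (λ x → f x * F₁ - f x * f x)     ≡⟨ Σ-- (λ x → f x * F₁) (λ x → f x * f x) ⟩
    Σ (λ x → f x * F₁) - F₂            ≡⟨ cong (_- F₂) (Σ-*ʳ f F₁) ⟩
    F₁ * F₁ - F₂                       ∎
    where
    open ≡-Reasoning
    distrib : ∀ a s → a * (s - a) ≡ a * s - a * a
    distrib = solve-∀

  G-square-row : ∀ x → Σ (λ y → G x y * G x y) ≡ (f x * f x) * Σ (λ y → off x y * (f y * f y))
  G-square-row x = trans (Σ-cong λ y → trans (regroup (off x y) (f x) (f y)) (cong (λ o → (f x * f x) * (o * (f y * f y))) (off-idem x y)))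
    (Σ-*ˡ (f x * f x) λ y → off x y * (f y * f y))
    where
    regroup : ∀ o a b → (o * (a * b)) * (o * (a * b)) ≡ (a * a) * ((o * o) * (b * b))
    regroup = solve-∀

  A-nonneg : 0ℤ ℤ.≤ A
  A-nonneg = Σ-nonneg λ x → Σ-nonneg λ y → square-nonneg (G x y)

  -- Row by row: `f x` factors out of `R x`, and Cauchy-Schwarz is applied to the remaining sum with
  -- the 0/1 weights `off x`, whose total is `u - 1`.
  W-bound : W ℤ.≤ (+ u - 1ℤ) * A
  W-bound = subst (W ℤ.≤_) (Σ-*ˡ (+ u - 1ℤ) λ x → Σ λ y → G x y * G x y) (Σ-mono row-bound)
    where
    off-total : ∀ x → Σ (off x) ≡ + u - 1ℤ
    off-total x = trans (Σ-cong λ y → sym (ℤ.*-identityʳ (off x y))) (trans (Σ-off x λ _ → 1ℤ)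
      (cong (_- 1ℤ) (trans (Σ-const u 1ℤ) (ℤ.*-identityʳ (+ u)))))
    regroup : ∀ a s → (a * s) * (a * s) ≡ (a * a) * (s * s)
    regroup = solve-∀
    difference : ∀ a n q s → n * (a * q) - a * s ≡ a * (n * q - s)
    difference = solve-∀
    row-bound : ∀ x → R x * R x ℤ.≤ (+ u - 1ℤ) * Σ (λ y → G x y * G x y)
    row-bound x = subst₂ ℤ._≤_ (sym (trans (cong₂ _*_ (G-row x) (G-row x)) (regroup (f x) s)))
        (cong ((+ u - 1ℤ) *_) (sym (G-square-row x)))
        (≤-from-nonneg (difference (f x * f x) (+ u - 1ℤ) q (s * s))
          (*-nonneg (square-nonneg (f x)) (ℤ.i≤j⇒0≤j-i (subst (λ n → s * s ℤ.≤ n * q) (off-total x) (cauchy (off x) f (off-nonneg x))))))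
      where
      s q : ℤ
      s = Σ λ y → off x y * f y
      q = Σ λ y → off x y * (f y * f y)

  -- Filling in the diagonal gives `A = F₂² - F₄`, and `F₂² ≤ u F₄` by Cauchy-Schwarz against the
  -- constant 1. This is the origin of the factor `1 - 1/u`.
  A-bound : + u * A ℤ.≤ (+ u - 1ℤ) * (F₂ * F₂)
  A-bound = subst (λ a → + u * a ℤ.≤ (+ u - 1ℤ) * (F₂ * F₂)) (sym A-value)
      (≤-from-nonneg (difference (+ u) (F₂ * F₂) F₄) (ℤ.i≤j⇒0≤j-i power-mean))
    where
    open ≡-Reasoning
    F₄ : ℤ
    F₄ = Σ λ x → (f x * f x) * (f x * f x)
    distrib : ∀ a s → a * (s - a) ≡ a * s - a * a
    distrib = solve-∀
    difference : ∀ n s t → (n - 1ℤ) * s - n * (s - t) ≡ n * t - s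
    difference = solve-∀
    A-value : A ≡ F₂ * F₂ - F₄
    A-value = begin
      A ≡⟨ Σ-cong (λ x → trans (G-square-row x) (trans (cong ((f x * f x) *_) (Σ-off x λ y → f y * f y)) (distrib (f x * f x) F₂))) ⟩
      Σ (λ x → (f x * f x) * F₂ - (f x * f x) * (f x * f x)) ≡⟨ Σ-- (λ x → (f x * f x) * F₂) _ ⟩
      Σ (λ x → (f x * f x) * F₂) - F₄                        ≡⟨ cong (_- F₄) (Σ-*ʳ (λ x → f x * f x) F₂) ⟩
      F₂ * F₂ - F₄ ∎
    unit : (g : Fin u → ℤ) → Σ (λ x → 1ℤ * g x) ≡ Σ g
    unit g = Σ-cong λ x → ℤ.*-identityˡ (g x)
    power-mean : F₂ * F₂ ℤ.≤ + u * F₄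
    power-mean = subst₂ ℤ._≤_ (cong₂ _*_ (unit λ x → f x * f x) (unit λ x → f x * f x))
      (cong₂ _*_ (trans (Σ-const u 1ℤ) (ℤ.*-identityʳ (+ u))) (unit λ x → (f x * f x) * (f x * f x)))
      (cauchy (λ _ → 1ℤ) (λ x → f x * f x) (λ _ → ℤ.+≤+ ℕ.z≤n))

module Moments {M u p : ℕ} (H : Family M u (suc p)) (univ : FourUniversal H) (4≤u : 4 ≤ u)
  (K : Fin (suc p) → Fin (suc p) → ℤ) (K-sym : ∀ a b → K a b ≡ K b a) (K-sum : Σ² K ≡ 1ℤ)
  (f : Fin u → ℤ) where

  open Universality H univ 4≤u
  open OffDiagonal f

  S c : ℤ
  S = Σ² λ a b → K a b * K a b
  c = Σ λ a → Σ² λ b d → K a b * K a d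

  -- Solved from the cases of `sharing`: one shared key must give `1 + α = c P`. Two shared keys
  -- switch on two of the four deltas, so `1 + 2 α + β = S P²`.
  α β : ℤ
  α = c * P - 1ℤ
  β = S * (P * P) - + 2 * c * P + 1ℤ

  κ : Fin (suc M) → Fin u → Fin u → ℤ
  κ k x y = K (H k x) (H k y)

  Y : Fin (suc M) → ℤ
  Y k = Σ² λ x y → G x y * κ k x y

  first-moment : P * P * Σ Y ≡ N * T
  first-moment = begin
    P * P * Σ Y
      ≡⟨ cong (P * P *_) (trans (Σ-swap λ k x → Σ λ y → G x y * κ k x y) (Σ-cong λ x → Σ-swap λ k y → G x y * κ k x y)) ⟩
    P * P * Σ² (λ x y → Σ λ k → G x y * κ k x y)
      ≡⟨ Σ²-*ˡ (P * P) (λ x y → Σ λ k → G x y * κ k x y) ⟨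
    Σ² (λ x y → P * P * Σ λ k → G x y * κ k x y)
      ≡⟨ Σ²-cong (λ x y → trans (cong (P * P *_) (Σ-*ˡ (G x y) λ k → κ k x y)) (pair x y)) ⟩
    Σ² (λ x y → N * G x y)
      ≡⟨ Σ²-*ˡ N G ⟩
    N * T ∎
    where
    open ≡-Reasoning
    exchange : ∀ p g s → p * (g * s) ≡ g * (p * s)
    exchange = solve-∀
    pair : ∀ x y → P * P * (G x y * Σ (λ k → κ k x y)) ≡ N * G x y
    pair x y with x ≟ y
    ... | yes refl = trans (cong (P * P *_) (ℤ.*-zeroˡ (Σ λ k → κ k x x))) (trans (ℤ.*-zeroʳ (P * P)) (sym (ℤ.*-zeroʳ N)))
    ... | no x≢y   = begin
      P * P * (1ℤ * (f x * f y) * Σ (λ k → κ k x y)) ≡⟨ exchange (P * P) (1ℤ * (f x * f y)) (Σ λ k → κ k x y) ⟩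
      1ℤ * (f x * f y) * (P * P * Σ (λ k → κ k x y)) ≡⟨ cong (1ℤ * (f x * f y) *_) (trans (expectation₂ x≢y K) (trans (cong (N *_) K-sum) (ℤ.*-identityʳ N))) ⟩
      1ℤ * (f x * f y) * N                           ≡⟨ ℤ.*-comm (1ℤ * (f x * f y)) N ⟩
      N * (1ℤ * (f x * f y))                         ∎

  -- The right-hand side is left in the shape to which `sharing` computes once the four key
  -- comparisons are decided: two deltas are 1, and one of the two products.
  reduce₂ : ∀ {x y} → x ≢ y → ∀ {g : Fin (suc M) → ℤ} (J : Fin (suc p) → Fin (suc p) → ℤ) →
    (∀ k → g k ≡ J (H k x) (H k y)) → Σ² J ≡ S →
    P * P * P * P * Σ g ≡ N * (1ℤ + α * + 2 + β * 1ℤ)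
  reduce₂ {x} {y} x≢y {g} J e s = begin
    P * P * P * P * Σ g                                  ≡⟨ cong (P * P * P * P *_) (Σ-cong e) ⟩
    P * P * P * P * Σ (λ k → J (H k x) (H k y))          ≡⟨ split P (Σ λ k → J (H k x) (H k y)) ⟩
    P * P * (P * P * Σ (λ k → J (H k x) (H k y)))        ≡⟨ cong (P * P *_) (trans (expectation₂ x≢y J) (cong (N *_) s)) ⟩
    P * P * (N * S)                                      ≡⟨ collect P N S c ⟩
    N * (1ℤ + α * + 2 + β * 1ℤ)                          ∎
    where
    open ≡-Reasoning
    split : ∀ p s → p * p * p * p * s ≡ p * p * (p * p * s)
    split = solve-∀
    collect : ∀ p n s c → p * p * (n * s) ≡ n * (1ℤ + (c * p - 1ℤ) * + 2 + (s * (p * p) - + 2 * c * p + 1ℤ) * 1ℤ)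
    collect = solve-∀

  reduce₃ : ∀ {x y z} → x ≢ y → x ≢ z → y ≢ z → ∀ {g : Fin (suc M) → ℤ} →
    (∀ k → g k ≡ κ k x y * κ k x z) →
    P * P * P * P * Σ g ≡ N * (1ℤ + α * 1ℤ + β * 0ℤ)
  reduce₃ {x} {y} {z} x≢y x≢z y≢z {g} e = begin
    P * P * P * P * Σ g                                  ≡⟨ cong (P * P * P * P *_) (Σ-cong e) ⟩
    P * P * P * P * Σ (λ k → κ k x y * κ k x z)          ≡⟨ split P (Σ λ k → κ k x y * κ k x z) ⟩
    P * (P * P * P * Σ (λ k → κ k x y * κ k x z))        ≡⟨ cong (P *_) (expectation₃ x≢y x≢z y≢z λ a b d → K a b * K a d) ⟩
    P * (N * c)                                          ≡⟨ collect P N c β ⟩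
    N * (1ℤ + α * 1ℤ + β * 0ℤ)                           ∎
    where
    open ≡-Reasoning
    split : ∀ p s → p * p * p * p * s ≡ p * (p * p * p * s)
    split = solve-∀
    collect : ∀ p n c b → p * (n * c) ≡ n * (1ℤ + (c * p - 1ℤ) * 1ℤ + b * 0ℤ)
    collect = solve-∀

  pair-pair : ∀ x y z w → x ≢ y → z ≢ w →
    P * P * P * P * Σ (λ k → κ k x y * κ k z w) ≡ N * sharing α β x y z w
  pair-pair x y z w x≢y z≢w with x ≟ z | x ≟ w | y ≟ z | y ≟ w
  -- If one key equals both keys of the other pair, that other pair collapses; the first four cases
  -- are therefore void.
  ... | yes refl | yes refl | _ | _ = ⊥-elim (z≢w refl)
  ... | yes refl | no _ | yes refl | _ = ⊥-elim (x≢y refl)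
  ... | no _ | yes refl | _ | yes refl = ⊥-elim (x≢y refl)
  ... | no _ | no _ | yes refl | yes refl = ⊥-elim (z≢w refl)
  ... | yes refl | no _ | no _ | yes refl = reduce₂ x≢y (λ a b → K a b * K a b) (λ k → refl) refl
  ... | no _ | yes refl | yes refl | no _ =
    reduce₂ x≢y (λ a b → K a b * K a b) (λ k → cong (κ k x y *_) (K-sym (H k y) (H k x))) refl
  -- Exactly one shared key. In these four cases symmetry of `K` moves it to the first argument of
  -- both factors wherever it is not already there.
  ... | yes refl | no x≢w | no _ | no y≢w = reduce₃ x≢y x≢w y≢w (λ k → refl)
  ... | no x≢z | yes refl | no y≢z | no _ =
    reduce₃ x≢y x≢z y≢z (λ k → cong (κ k x y *_) (K-sym (H k z) (H k x)))
  ... | no _ | no x≢w | yes refl | no y≢w =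
    reduce₃ (λ e → x≢y (sym e)) y≢w x≢w (λ k → cong (_* κ k y w) (K-sym (H k x) (H k y)))
  ... | no x≢z | no _ | no y≢z | yes refl =
    reduce₃ (λ e → x≢y (sym e)) y≢z x≢z (λ k → cong₂ _*_ (K-sym (H k x) (H k y)) (K-sym (H k z) (H k y)))
  ... | no x≢z | no x≢w | no y≢z | no y≢w = begin
    P * P * P * P * Σ (λ k → κ k x y * κ k z w)
      ≡⟨ expectation₄ x≢y x≢z x≢w y≢z y≢w z≢w (λ a b c d → K a b * K c d) ⟩
    N * Σ⁴ (λ a b c d → K a b * K c d)
      ≡⟨ cong (N *_) (trans (sym (Σ²-square K)) (cong₂ _*_ K-sum K-sum)) ⟩
    N * 1ℤ
      ≡⟨ cong (N *_) (collect α β) ⟩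
    N * (1ℤ + α * 0ℤ + β * 0ℤ) ∎
    where
    open ≡-Reasoning
    collect : ∀ a b → 1ℤ ≡ 1ℤ + a * 0ℤ + b * 0ℤ
    collect = solve-∀

  second-moment : P * P * P * P * Σ (λ k → Y k * Y k) ≡ N * (T * T + + 4 * α * W + + 2 * β * A)
  second-moment = begin
    P * P * P * P * Σ (λ k → Y k * Y k)
      ≡⟨ cong (P * P * P * P *_) (trans (Σ-cong λ k → Σ²-square λ x y → G x y * κ k x y) (Σ-Σ⁴-swap λ k x y z w → (G x y * κ k x y) * (G z w * κ k z w))) ⟩
    P * P * P * P * Σ⁴ (λ x y z w → Σ λ k → (G x y * κ k x y) * (G z w * κ k z w))
      ≡⟨ Σ⁴-*ˡ (P * P * P * P) (λ x y z w → Σ λ k → (G x y * κ k x y) * (G z w * κ k z w)) ⟨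
    Σ⁴ (λ x y z w → P * P * P * P * Σ λ k → (G x y * κ k x y) * (G z w * κ k z w))
      ≡⟨ Σ⁴-cong (λ x y z w → trans (cong (P * P * P * P *_) (trans (Σ-cong λ k → regroup (G x y) (κ k x y) (G z w) (κ k z w))
           (Σ-*ˡ (G x y * G z w) λ k → κ k x y * κ k z w))) (quadruple x y z w)) ⟩
    Σ⁴ (λ x y z w → N * ((G x y * G z w) * sharing α β x y z w))
      ≡⟨ Σ⁴-*ˡ N (λ x y z w → (G x y * G z w) * sharing α β x y z w) ⟩
    N * Σ⁴ (λ x y z w → (G x y * G z w) * sharing α β x y z w)
      ≡⟨ cong (N *_) (total-sharing α β) ⟩
    N * (T * T + + 4 * α * W + + 2 * β * A) ∎
    where
    open ≡-Reasoning
    regroup : ∀ a b c d → (a * b) * (c * d) ≡ (a * c) * (b * d)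
    regroup = solve-∀
    exchange : ∀ p g s → p * (g * s) ≡ g * (p * s)
    exchange = solve-∀
    G-diagonal : ∀ x → G x x ≡ 0ℤ
    G-diagonal x = trans (cong (_* (f x * f x)) (off-refl x)) (ℤ.*-zeroˡ (f x * f x))
    vanish : ∀ {g} q n s t → g ≡ 0ℤ → q * (g * s) ≡ n * (g * t)
    vanish q n s t refl = trans (cong (q *_) (ℤ.*-zeroˡ s)) (trans (ℤ.*-zeroʳ q)
      (sym (trans (cong (n *_) (ℤ.*-zeroˡ t)) (ℤ.*-zeroʳ n))))
    quadruple : ∀ x y z w → P * P * P * P * ((G x y * G z w) * Σ (λ k → κ k x y * κ k z w))
      ≡ N * ((G x y * G z w) * sharing α β x y z w)
    quadruple x y z w = cases (x ≟ y) (z ≟ w)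
      where
      cases : Dec (x ≡ y) → Dec (z ≡ w) → P * P * P * P * ((G x y * G z w) * Σ (λ k → κ k x y * κ k z w))
        ≡ N * ((G x y * G z w) * sharing α β x y z w)
      -- A degenerate pair has weight zero, so `sharing` need not describe its kernel value.
      cases (yes refl) _ = vanish (P * P * P * P) N (Σ λ k → κ k x x * κ k z w) (sharing α β x x z w)
        (trans (cong (_* G z w) (G-diagonal x)) (ℤ.*-zeroˡ (G z w)))
      cases (no _) (yes refl) = vanish (P * P * P * P) N (Σ λ k → κ k x y * κ k z z) (sharing α β x y z z)
        (trans (cong (G x y *_) (G-diagonal z)) (ℤ.*-zeroʳ (G x y)))
      cases (no x≢y) (no z≢w) = trans (exchange (P * P * P * P) (G x y * G z w) (Σ λ k → κ k x y * κ k z w))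
        (trans (cong ((G x y * G z w) *_) (pair-pair x y z w x≢y z≢w)) (exchange (G x y * G z w) N (sharing α β x y z w)))

  -- `N * Σ Y² - (Σ Y)²` is `N²` times the variance of `Y`, free of denominators.
  scaled-variance : P * P * P * P * (N * Σ (λ k → Y k * Y k) - Σ Y * Σ Y) ≡ N * N * (+ 4 * α * W + + 2 * β * A)
  scaled-variance = begin
    P * P * P * P * (N * Q - s * s)                              ≡⟨ split P N Q s ⟩
    N * (P * P * P * P * Q) - (P * P * s) * (P * P * s)          ≡⟨ cong₂ (λ a b → N * a - b * b) second-moment first-moment ⟩
    N * (N * (T * T + + 4 * α * W + + 2 * β * A)) - (N * T) * (N * T) ≡⟨ cancel N T (+ 4 * α * W) (+ 2 * β * A) ⟩
    N * N * (+ 4 * α * W + + 2 * β * A) ∎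
    where
    open ≡-Reasoning
    Q s : ℤ
    Q = Σ λ k → Y k * Y k
    s = Σ Y
    split : ∀ p n q s → p * p * p * p * (n * q - s * s) ≡ n * (p * p * p * p * q) - (p * p * s) * (p * p * s)
    split = solve-∀
    cancel : ∀ n t a b → n * (n * (t * t + a + b)) - (n * t) * (n * t) ≡ n * n * (a + b)
    cancel = solve-∀

-- The numerical inequality

*-pos : ∀ {a b} → 0ℤ ℤ.< a → 0ℤ ℤ.< b → 0ℤ ℤ.< a * b
*-pos {+ suc m} {+ suc n} _ _ = ℤ.+<+ ℕ.z<s
*-pos {+ zero} (ℤ.+<+ ())
*-pos {+ suc m} {+ zero} _ (ℤ.+<+ ())

half-pos : ∀ {a} → 0ℤ ℤ.< + 2 * a → 0ℤ ℤ.< a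
half-pos {+ zero}        (ℤ.+<+ ())
half-pos {+ suc n}       _ = ℤ.+<+ ℕ.z<s
half-pos {ℤ.-[1+ n ]} ()

<-from-pos : ∀ {a b d} → b - a ≡ d → 0ℤ ℤ.< d → a ℤ.< b
<-from-pos {a} {b} {d} e d>0 = subst₂ ℤ._<_ (ℤ.+-identityˡ a) (trans (cong (_+ a) (sym e)) (cancel a b)) (ℤ.+-monoˡ-< a d>0)
  where
  cancel : ∀ a b → b - a + a ≡ b
  cancel = solve-∀

-- `n` stands for the number of residues in bucket 0 and `F` for `F₂²`. Hypotheses are used as
-- nonnegative differences, so that each estimate becomes a polynomial identity with a visibly
-- nonnegative side.
module Bound (u p r n S A W F : ℤ)
  (u≥2 : 0ℤ ℤ.≤ u - + 2) (p≥2u-1 : 0ℤ ℤ.≤ 1ℤ + p - + 2 * u)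
  (r≥1 : 0ℤ ℤ.≤ r - 1ℤ) (r≤p+1 : 0ℤ ℤ.≤ 1ℤ + p - r)
  (n≥1 : 0ℤ ℤ.≤ n - 1ℤ)
  (n-large : 0ℤ ℤ.≤ + 2 * (r * n) - (1ℤ + p))
  (S-small : r * S ℤ.≤ (1ℤ + p) * (1ℤ + p) + r * r - + 4 * (r * n) + r)
  (A≥0 : 0ℤ ℤ.≤ A) (F>0 : 0ℤ ℤ.< F) (W≤A : W ℤ.≤ (u - 1ℤ) * A) (A≤F : u * A ℤ.≤ (u - 1ℤ) * F) where

  -- `κ` is chosen so that `V ≤ 2 A p κ`. `E` is the resulting bound on `r κ` in the worst case
  -- `2 r n = q`. `D` equals `E q² - p³ (q² + r²)`, the amount by which the estimate would fail
  -- without the factor `1 - 1/u`.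
  q c α β V κ E D : ℤ
  q = 1ℤ + p
  c = + 2 * n - 1ℤ
  α = c * p - 1ℤ
  β = S * (p * p) - + 2 * c * p + 1ℤ
  V = + 4 * α * W + + 2 * β * A
  κ = + 2 * c * (u - + 2) + S * p
  E = p * (q * q + r * r + r - + 2 * q) + + 2 * (u - + 2) * (q - r)
  D = p * (r * r * (q + p) + q * q * (r - 1ℤ)) + + 2 * (u - + 2) * (q - r) * (q * q)

  private
    0≤1 : 0ℤ ℤ.≤ 1ℤ
    0≤1 = ℤ.+≤+ ℕ.z≤n

    0≤2 : 0ℤ ℤ.≤ + 2
    0≤2 = ℤ.+≤+ ℕ.z≤n

    0≤4 : 0ℤ ℤ.≤ + 4
    0≤4 = ℤ.+≤+ ℕ.z≤n

    0<2 : 0ℤ ℤ.< + 2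
    0<2 = ℤ.+<+ ℕ.z<s

  u≥1 : 0ℤ ℤ.≤ u - 1ℤ
  u≥1 = subst (0ℤ ℤ.≤_) (e u) (+-nonneg u≥2 0≤1)
    where e : ∀ u → u - + 2 + 1ℤ ≡ u - 1ℤ
          e = solve-∀

  u>0 : 0ℤ ℤ.< u
  u>0 = subst (0ℤ ℤ.<_) (e u) (ℤ.+-mono-≤-< u≥2 0<2)
    where e : ∀ u → u - + 2 + + 2 ≡ u
          e = solve-∀

  p≥3 : 0ℤ ℤ.≤ p - + 3
  p≥3 = subst (0ℤ ℤ.≤_) (e u p) (+-nonneg p≥2u-1 (*-nonneg 0≤2 u≥2))
    where e : ∀ u p → 1ℤ + p - + 2 * u + + 2 * (u - + 2) ≡ p - + 3
          e = solve-∀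

  p>0 : 0ℤ ℤ.< p
  p>0 = subst (0ℤ ℤ.<_) (e p) (ℤ.+-mono-≤-< p≥3 (ℤ.+<+ (ℕ.z<s {2})))
    where e : ∀ p → p - + 3 + + 3 ≡ p
          e = solve-∀

  p≥0 = ℤ.<⇒≤ p>0

  q>0 : 0ℤ ℤ.< q
  q>0 = ℤ.+-mono-≤-< 0≤1 p>0

  q≥0 = ℤ.<⇒≤ q>0

  r>0 : 0ℤ ℤ.< r
  r>0 = subst (0ℤ ℤ.<_) (e r) (ℤ.+-mono-≤-< r≥1 (ℤ.+<+ (ℕ.z<s {0})))
    where e : ∀ r → r - 1ℤ + 1ℤ ≡ r
          e = solve-∀

  r≥0 = ℤ.<⇒≤ r>0

  α≥0 : 0ℤ ℤ.≤ α
  α≥0 = subst (0ℤ ℤ.≤_) (e n p) (+-nonneg (+-nonneg (*-nonneg (*-nonneg 0≤2 n≥1) p≥0) p≥3) 0≤2)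
    where e : ∀ n p → + 2 * (n - 1ℤ) * p + (p - + 3) + + 2 ≡ (+ 2 * n - 1ℤ) * p - 1ℤ
          e = solve-∀

  -- As `α ≥ 0`, `W` may be replaced by `(u - 1) A`. The term `- 2 c p` of `β` then cancels one of
  -- the `u - 1` copies of `2 c p`, which explains the `u - 2` in `κ`; a surplus of `2 u - 3` is
  -- discarded.
  V-bound : 0ℤ ℤ.≤ + 2 * A * p * κ - V
  V-bound = subst (0ℤ ℤ.≤_) (e (+ 2 * n - 1ℤ) p S u A W)
      (+-nonneg (*-nonneg (*-nonneg 0≤4 α≥0) (ℤ.i≤j⇒0≤j-i W≤A)) (*-nonneg (*-nonneg 0≤2 A≥0) (+-nonneg u≥2 u≥1)))
    where
    e : ∀ c p S u A W → + 4 * (c * p - 1ℤ) * ((u - 1ℤ) * A - W) + + 2 * A * (u - + 2 + (u - 1ℤ))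
      ≡ + 2 * A * p * (+ 2 * c * (u - + 2) + S * p) - (+ 4 * (c * p - 1ℤ) * W + + 2 * (S * (p * p) - + 2 * c * p + 1ℤ) * A)
    e = solve-∀

  -- A large bucket 0 increases `c` but lowers the bound on `S`. In the bound on `r κ` the
  -- coefficient of `r n` is `4 (u - 2) - 4 p`, which is negative, so the smallest admissible `n` is
  -- the worst.
  κ-bound : 0ℤ ℤ.≤ E - r * κ
  κ-bound = subst (0ℤ ℤ.≤_) (e p r n S u)
      (+-nonneg (*-nonneg p≥0 (ℤ.i≤j⇒0≤j-i S-small)) (*-nonneg (*-nonneg 0≤2 n-large)
        (subst (0ℤ ℤ.≤_) (e′ u p) (+-nonneg (+-nonneg p≥2u-1 u≥1) 0≤2))))
    where
    e′ : ∀ u p → 1ℤ + p - + 2 * u + (u - 1ℤ) + + 2 ≡ p - (u - + 2)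
    e′ = solve-∀
    e : ∀ p r n S u → p * ((1ℤ + p) * (1ℤ + p) + r * r - + 4 * (r * n) + r - r * S)
        + + 2 * (+ 2 * (r * n) - (1ℤ + p)) * (p - (u - + 2))
      ≡ p * ((1ℤ + p) * (1ℤ + p) + r * r + r - + 2 * (1ℤ + p)) + + 2 * (u - + 2) * (1ℤ + p - r)
        - r * (+ 2 * (+ 2 * n - 1ℤ) * (u - + 2) + S * p)
    e = solve-∀

  E≥0 : 0ℤ ℤ.≤ E
  E≥0 = +-nonneg (*-nonneg p≥0 (subst (0ℤ ℤ.≤_) (e p r)
      (+-nonneg (*-nonneg q≥0 (+-nonneg p≥3 0≤2)) (+-nonneg (square-nonneg r) r≥0)))) (*-nonneg (*-nonneg 0≤2 u≥2) r≤p+1)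
    where
    e : ∀ p r → (1ℤ + p) * (p - + 3 + + 2) + (r * r + r) ≡ (1ℤ + p) * (1ℤ + p) + r * r + r - + 2 * (1ℤ + p)
    e = solve-∀

  D≥0 : 0ℤ ℤ.≤ D
  D≥0 = +-nonneg (*-nonneg p≥0 (+-nonneg (*-nonneg (square-nonneg r) (+-nonneg q≥0 p≥0)) (*-nonneg (square-nonneg q) r≥1)))
    (*-nonneg (*-nonneg (*-nonneg 0≤2 u≥2) r≤p+1) (square-nonneg q))

  Z : ℤ
  Z = u * (p * p * p * (q * q + r * r)) - (u - 1ℤ) * (E * (q * q))

  -- By the meaning of `D`, `Z = E q² - u D`. In `2 Z` the factor `2 u` is replaced by
  -- `q + 1 = p + 2`, with remainder `(q - 2 u + 1) D ≥ 0`; this choice leaves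
  -- `2 p³ (q² + r²) - p D`, which is divisible by `p`. There `2 (u - 2)` is rewritten as
  -- `p - (q - 2 u + 3)`, and the terms linear in `r` cancel.
  Z>0 : 0ℤ ℤ.< Z
  Z>0 = half-pos (subst (0ℤ ℤ.<_) (e p r u) (ℤ.+-mono-<-≤ leading rest))
    where
    leading : 0ℤ ℤ.< p * (p * ((p - + 3 + + 2) * (q * q) + (q - r) * (q + r)))
    leading = *-pos p>0 (*-pos p>0 (ℤ.+-mono-<-≤ (*-pos (ℤ.+-mono-≤-< p≥3 0<2) (*-pos q>0 q>0)) (*-nonneg r≤p+1 (+-nonneg q≥0 r≥0))))
    rest : 0ℤ ℤ.≤ p * ((q - + 2 * u + + 3) * ((q - r) * (q * q))) + (q - + 2 * u + 1ℤ) * D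
    rest = +-nonneg (*-nonneg p≥0 (*-nonneg (+-nonneg p≥2u-1 (ℤ.+≤+ (ℕ.z≤n {3}))) (*-nonneg r≤p+1 (square-nonneg q))))
      (*-nonneg (+-nonneg p≥2u-1 0≤1) D≥0)
    e : ∀ p r u → p * (p * ((p - + 3 + + 2) * ((1ℤ + p) * (1ℤ + p)) + (1ℤ + p - r) * (1ℤ + p + r)))
        + (p * ((1ℤ + p - + 2 * u + + 3) * ((1ℤ + p - r) * ((1ℤ + p) * (1ℤ + p)))) + (1ℤ + p - + 2 * u + 1ℤ)
           * (p * (r * r * (1ℤ + p + p) + (1ℤ + p) * (1ℤ + p) * (r - 1ℤ)) + + 2 * (u - + 2) * (1ℤ + p - r) * ((1ℤ + p) * (1ℤ + p))))
      ≡ + 2 * (u * (p * p * p * ((1ℤ + p) * (1ℤ + p) + r * r))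
        - (u - 1ℤ) * ((p * ((1ℤ + p) * (1ℤ + p) + r * r + r - + 2 * (1ℤ + p)) + + 2 * (u - + 2) * (1ℤ + p - r)) * ((1ℤ + p) * (1ℤ + p))))
    e = solve-∀

  -- The difference of the two sides, times `u`, telescopes into the slacks of the chain
  -- `V ≤ 2 A p κ`, `r κ ≤ E`, `u A ≤ (u - 1) F`, plus a multiple of `Z`, which alone is strict.
  variance-bound : V * (q * q * r) ℤ.< + 2 * (q * q + r * r) * F * (p * p * p * p)
  variance-bound = ℤ.*-cancelˡ-<-nonNeg u {{ℤ.nonNegative (ℤ.<⇒≤ u>0)}}
      (<-from-pos (e u p q r F A V κ E)
        (ℤ.+-mono-<-≤ (*-pos (*-pos (*-pos 0<2 p>0) F>0) Z>0)
          (+-nonneg (*-nonneg (*-nonneg (*-nonneg 0≤2 p≥0) (*-nonneg E≥0 (square-nonneg q))) (ℤ.i≤j⇒0≤j-i A≤F))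
          (+-nonneg (*-nonneg (*-nonneg (*-nonneg (*-nonneg 0≤2 p≥0) (square-nonneg q)) (*-nonneg (ℤ.<⇒≤ u>0) A≥0)) κ-bound)
            (*-nonneg (*-nonneg (*-nonneg (ℤ.<⇒≤ u>0) (square-nonneg q)) r≥0) V-bound)))))
    where
    e : ∀ u p q r F A V κ E → u * (+ 2 * (q * q + r * r) * F * (p * p * p * p)) - u * (V * (q * q * r))
      ≡ + 2 * p * F * (u * (p * p * p * (q * q + r * r)) - (u - 1ℤ) * (E * (q * q)))
        + (+ 2 * p * (E * (q * q)) * ((u - 1ℤ) * F - u * A)
        + (+ 2 * p * (q * q) * (u * A) * (E - r * κ)
        + u * (q * q) * r * (+ 2 * A * p * κ - V)))
    e = solve-∀

-- The sign kernel of the sketch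

𝟙-yes : {A : Set} (d : Dec A) → A → 𝟙 ⌊ d ⌋ ≡ 1ℤ
𝟙-yes (yes _) a = refl
𝟙-yes (no na) a = ⊥-elim (na a)

𝟙-no : {A : Set} (d : Dec A) → ¬ A → 𝟙 ⌊ d ⌋ ≡ 0ℤ
𝟙-no (yes a) na = ⊥-elim (na a)
𝟙-no (no _)  na = refl

𝟙-⇔ : {A B : Set} (d : Dec A) (e : Dec B) → (A → B) → (B → A) → 𝟙 ⌊ d ⌋ ≡ 𝟙 ⌊ e ⌋
𝟙-⇔ (yes a) e to from = sym (𝟙-yes e (to a))
𝟙-⇔ (no na) e to from = sym (𝟙-no e λ b → na (from b))

𝟙-idem : ∀ c → 𝟙 c * 𝟙 c ≡ 𝟙 c
𝟙-idem true  = refl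
𝟙-idem false = refl

Σ-append : ∀ m n (g : ℕ → ℤ) → Σ {m ℕ.+ n} (g ∘ toℕ) ≡ Σ {m} (g ∘ toℕ) + Σ {n} (λ j → g (m ℕ.+ toℕ j))
Σ-append zero    n g = sym (trans (cong (_+ Σ {n} (g ∘ toℕ)) (Σ-[] (g ∘ toℕ))) (ℤ.+-identityˡ (Σ {n} (g ∘ toℕ))))
Σ-append (suc m) n g = begin
  Σ {suc m ℕ.+ n} (g ∘ toℕ)
    ≡⟨ Σ-∷ _ ⟩
  g 0 + Σ {m ℕ.+ n} (g ∘ suc ∘ toℕ)
    ≡⟨ cong (_+_ (g 0)) (Σ-append m n (g ∘ suc)) ⟩
  g 0 + (Σ {m} (g ∘ suc ∘ toℕ) + rest)
    ≡⟨ ℤ.+-assoc (g 0) (Σ {m} (g ∘ suc ∘ toℕ)) rest ⟨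
  g 0 + Σ {m} (g ∘ suc ∘ toℕ) + rest
    ≡⟨ cong (_+ rest) (Σ-∷ (g ∘ toℕ)) ⟨
  Σ {suc m} (g ∘ toℕ) + rest ∎
  where
  open ≡-Reasoning
  rest = Σ {n} (λ j → g (suc m ℕ.+ toℕ j))

-- The keys hash to 1, …, p with p + 1 = 2Q, so a sum over hash values misses only the argument 0.
Σ-fold : ∀ {p Q} → suc p ≡ Q ℕ.+ Q → (g : ℕ → ℤ) →
  Σ {p} (λ a → g (suc (toℕ a))) ≡ Σ {Q} (λ j → g (toℕ j) + g (Q ℕ.+ toℕ j)) - g 0
Σ-fold {p} {Q} e g = begin
  Σ {p} (λ a → g (suc (toℕ a)))                       ≡⟨ cancel (g 0) (Σ {p} (λ a → g (suc (toℕ a)))) ⟩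
  g 0 + Σ {p} (λ a → g (suc (toℕ a))) - g 0           ≡⟨ cong (_- g 0) (Σ-∷ {p} (g ∘ toℕ)) ⟨
  Σ {suc p} (g ∘ toℕ) - g 0                           ≡⟨ cong (λ m → Σ {m} (g ∘ toℕ) - g 0) e ⟩
  Σ {Q ℕ.+ Q} (g ∘ toℕ) - g 0                         ≡⟨ cong (_- g 0) (trans (Σ-append Q Q g) (sym (Σ-+ (g ∘ toℕ) λ j → g (Q ℕ.+ toℕ j)))) ⟩
  Σ {Q} (λ j → g (toℕ j) + g (Q ℕ.+ toℕ j)) - g 0     ∎
  where
  open ≡-Reasoning
  cancel : ∀ a b → b ≡ a + b - a
  cancel = solve-∀

Σ-initial : ∀ {n} l → l ≤ n → Σ {n} (λ j → 𝟙 ⌊ toℕ j ℕ.<? l ⌋) ≡ + l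
Σ-initial {n} zero _ = Σ-zero λ j → 𝟙-no (toℕ j ℕ.<? 0) λ ()
Σ-initial {suc n} (suc l) (ℕ.s≤s l≤n) = trans (Σ-∷ _) (cong (_+_ 1ℤ) (trans
  (Σ-cong λ j → 𝟙-⇔ (suc (toℕ j) ℕ.<? suc l) (toℕ j ℕ.<? l) ℕ.s≤s⁻¹ ℕ.s≤s) (Σ-initial l l≤n)))

-- `K` is a Gram kernel; `orthogonal` says that at each point at most one feature is nonzero.
module Features {r p : ℕ} (φ : Fin r → Fin p → ℤ)
  (orthogonal : ∀ t t′ a → φ t a * φ t′ a ≡ δ t t′ * (φ t a * φ t a)) where

  K : Fin p → Fin p → ℤ
  K a b = Σ λ t → φ t a * φ t b

  K-sym : ∀ a b → K a b ≡ K b a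
  K-sym a b = Σ-cong λ t → ℤ.*-comm (φ t a) (φ t b)

  μ c : Fin r → ℤ
  μ t = Σ (φ t)
  c t = Σ λ a → φ t a * φ t a

  K-sum : Σ² K ≡ Σ (λ t → μ t * μ t)
  K-sum = trans (Σ-cong λ a → Σ-swap λ b t → φ t a * φ t b)
    (trans (Σ-swap λ a t → Σ λ b → φ t a * φ t b) (Σ-cong λ t → Σ-prod (φ t) (φ t)))

  -- Orthogonality at the common point `a` collapses the double sum over features to its diagonal.
  K-product : ∀ a b d → K a b * K a d ≡ Σ λ t → (φ t a * φ t a) * (φ t b * φ t d)
  K-product a b d = begin
    K a b * K a d
      ≡⟨ Σ-prod (λ t → φ t a * φ t b) (λ t → φ t a * φ t d) ⟨
    Σ² (λ t t′ → (φ t a * φ t b) * (φ t′ a * φ t′ d))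
      ≡⟨ Σ²-cong (λ t t′ → trans (group (φ t a) (φ t b) (φ t′ a) (φ t′ d)) (trans (cong (_* (φ t b * φ t′ d)) (orthogonal t t′ a))
           (ℤ.*-assoc (δ t t′) (φ t a * φ t a) (φ t b * φ t′ d)))) ⟩
    Σ² (λ t t′ → δ t t′ * ((φ t a * φ t a) * (φ t b * φ t′ d)))
      ≡⟨ Σ-cong (λ t → Σ-δ t λ t′ → (φ t a * φ t a) * (φ t b * φ t′ d)) ⟩
    Σ (λ t → (φ t a * φ t a) * (φ t b * φ t d)) ∎
    where
    open ≡-Reasoning
    group : ∀ a b c d → (a * b) * (c * d) ≡ (a * c) * (b * d)
    group = solve-∀

  K-square-sum : Σ² (λ a b → K a b * K a b) ≡ Σ (λ t → c t * c t)
  K-square-sum = trans (Σ-cong λ a → trans (Σ-cong λ b → K-product a b b) (Σ-swap λ b t → (φ t a * φ t a) * (φ t b * φ t b)))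
    (trans (Σ-swap λ a t → Σ λ b → (φ t a * φ t a) * (φ t b * φ t b))
      (Σ-cong λ t → Σ-prod (λ a → φ t a * φ t a) (λ b → φ t b * φ t b)))

  -- Summing over the two free endpoints gives `μ t` twice; summing over the middle point gives
  -- `c t`.
  K-path-sum : Σ (λ a → Σ² λ b d → K a b * K a d) ≡ Σ (λ t → c t * (μ t * μ t))
  K-path-sum = begin
    Σ (λ a → Σ² λ b d → K a b * K a d)
      ≡⟨ Σ-cong (λ a → trans (Σ-cong λ b → trans (Σ-cong λ d → K-product a b d) (Σ-swap λ d t → (φ t a * φ t a) * (φ t b * φ t d)))
           (Σ-swap λ b t → Σ λ d → (φ t a * φ t a) * (φ t b * φ t d))) ⟩
    Σ (λ a → Σ λ t → Σ² λ b d → (φ t a * φ t a) * (φ t b * φ t d))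
      ≡⟨ Σ-cong (λ a → Σ-cong λ t → trans (Σ²-*ˡ (φ t a * φ t a) λ b d → φ t b * φ t d) (cong ((φ t a * φ t a) *_) (Σ-prod (φ t) (φ t)))) ⟩
    Σ (λ a → Σ λ t → (φ t a * φ t a) * (μ t * μ t))
      ≡⟨ trans (Σ-swap λ a t → (φ t a * φ t a) * (μ t * μ t)) (Σ-cong λ t → Σ-*ʳ (λ a → φ t a * φ t a) (μ t * μ t)) ⟩
    Σ (λ t → c t * (μ t * μ t)) ∎
    where open ≡-Reasoning

module Sketch (Q r′ p : ℕ) {{_ : NonZero Q}} (p+1≡2Q : suc p ≡ Q ℕ.+ Q) where

  r : ℕ
  r = suc r′

  bucket : ℕ → ℕ
  bucket h = (r ℕ.* (h % Q)) / Q

  sign : ℕ → ℤ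
  sign h = 1ℤ - + 2 * + (h / Q)

  -- Defined on all naturals, so that it can also be evaluated at 0, the argument that no key
  -- attains.
  ψ : ℕ → ℕ → ℤ
  ψ t h = if ⌊ bucket h ℕ.≟ t ⌋ then sign h else 0ℤ

  φ : Fin r → Fin p → ℤ
  φ t a = ψ (toℕ t) (suc (toℕ a))

  orthogonal : ∀ t t′ a → φ t a * φ t′ a ≡ δ t t′ * (φ t a * φ t a)
  orthogonal t t′ a = cases (bucket h ℕ.≟ toℕ t) (bucket h ℕ.≟ toℕ t′)
    where
    h = suc (toℕ a)
    s = sign h
    cases : (d : Dec (bucket h ≡ toℕ t)) (d′ : Dec (bucket h ≡ toℕ t′)) →
      (if ⌊ d ⌋ then s else 0ℤ) * (if ⌊ d′ ⌋ then s else 0ℤ)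
      ≡ δ t t′ * ((if ⌊ d ⌋ then s else 0ℤ) * (if ⌊ d ⌋ then s else 0ℤ))
    cases (no _)  d′      = trans (ℤ.*-zeroˡ (if ⌊ d′ ⌋ then s else 0ℤ)) (sym (ℤ.*-zeroʳ (δ t t′)))
    cases (yes e) (yes e′) = sym (trans (cong (_* (s * s)) (𝟙-yes (t ≟ t′) (Fin.toℕ-injective (trans (sym e) e′)))) (ℤ.*-identityˡ (s * s)))
    cases (yes e) (no ne) = trans (ℤ.*-zeroʳ s) (sym (trans (cong (_* (s * s)) (𝟙-no (t ≟ t′) λ { refl → ne e })) (ℤ.*-zeroˡ (s * s))))

  open Features φ orthogonal public

  hits : ℕ → ℕ → ℤ
  hits t h = 𝟙 ⌊ bucket h ℕ.≟ t ⌋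

  ψ-sign : ∀ t h → ψ t h ≡ hits t h * sign h
  ψ-sign t h with bucket h ℕ.≟ t
  ... | yes _ = sym (ℤ.*-identityˡ (sign h))
  ... | no _  = sym (ℤ.*-zeroˡ (sign h))

  sign-low : ∀ {h} → h < Q → sign h ≡ 1ℤ
  sign-low h<Q = cong (λ a → 1ℤ - + 2 * + a) (ℕ.m<n⇒m/n≡0 h<Q)

  sign-high : ∀ {h} → h < Q → sign (Q ℕ.+ h) ≡ - 1ℤ
  sign-high {h} h<Q = cong (λ a → 1ℤ - + 2 * + a) (begin
    (Q ℕ.+ h) / Q     ≡⟨ ℕ.m/n≡1+[m∸n]/n (ℕ.m≤m+n Q h) ⟩
    suc ((Q ℕ.+ h ∸ Q) / Q) ≡⟨ cong (λ a → suc (a / Q)) (ℕ.m+n∸m≡n Q h) ⟩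
    suc (h / Q)       ≡⟨ cong suc (ℕ.m<n⇒m/n≡0 h<Q) ⟩
    1                 ∎)
    where open ≡-Reasoning

  bucket-high : ∀ h → bucket (Q ℕ.+ h) ≡ bucket h
  bucket-high h = cong (λ j → (r ℕ.* j) / Q) (trans (cong (_% Q) (ℕ.+-comm Q h)) (ℕ.[m+n]%n≡m%n h Q))

  hits-high : ∀ t h → hits t (Q ℕ.+ h) ≡ hits t h
  hits-high t h = cong (λ i → 𝟙 ⌊ i ℕ.≟ t ⌋) (bucket-high h)

  ψ-low : ∀ t {h} → h < Q → ψ t h ≡ hits t h
  ψ-low t {h} h<Q = trans (ψ-sign t h) (trans (cong (hits t h *_) (sign-low h<Q)) (ℤ.*-identityʳ (hits t h)))

  ψ-high : ∀ t {h} → h < Q → ψ t (Q ℕ.+ h) ≡ - hits t h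
  ψ-high t {h} h<Q = trans (ψ-sign t (Q ℕ.+ h)) (trans (cong₂ _*_ (hits-high t h) (sign-high h<Q)) (negate (hits t h)))
    where
    negate : ∀ a → a * (- 1ℤ) ≡ - a
    negate = solve-∀

  0<Q : 0 < Q
  0<Q = ℕ.>-nonZero⁻¹ Q

  ψ-0 : ∀ (t : Fin r) → ψ (toℕ t) 0 ≡ δ Fin.zero t
  ψ-0 t = trans (ψ-low (toℕ t) 0<Q) (𝟙-⇔ (bucket 0 ℕ.≟ toℕ t) (Fin.zero ≟ t)
      (λ e → Fin.toℕ-injective (trans (sym bucket-0) e)) (λ e → trans bucket-0 (cong toℕ e)))
    where
    bucket-0 : bucket 0 ≡ 0
    bucket-0 = trans (cong (λ j → (r ℕ.* j) / Q) (ℕ.m<n⇒m%n≡m 0<Q)) (trans (cong (_/ Q) (ℕ.*-zeroʳ r)) (ℕ.0/n≡0 Q))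

  occupancy : ℕ → ℤ
  occupancy t = Σ {Q} λ j → hits t (toℕ j)

  μ-value : ∀ t → μ t ≡ - δ Fin.zero t
  μ-value t = begin
    μ t                                                       ≡⟨ Σ-fold p+1≡2Q (ψ (toℕ t)) ⟩
    Σ {Q} (λ j → ψ (toℕ t) (toℕ j) + ψ (toℕ t) (Q ℕ.+ toℕ j)) - ψ (toℕ t) 0 ≡⟨ cong₂ _-_ (Σ-zero balanced) (ψ-0 t) ⟩
    0ℤ - δ Fin.zero t                                         ≡⟨ ℤ.+-identityˡ (- δ Fin.zero t) ⟩
    - δ Fin.zero t                                            ∎
    where
    open ≡-Reasoning
    balanced : ∀ (j : Fin Q) → ψ (toℕ t) (toℕ j) + ψ (toℕ t) (Q ℕ.+ toℕ j) ≡ 0ℤ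
    balanced j = trans (cong₂ _+_ (ψ-low (toℕ t) (Fin.toℕ<n j)) (ψ-high (toℕ t) (Fin.toℕ<n j))) (ℤ.+-inverseʳ (hits (toℕ t) (toℕ j)))

  -- Squaring removes the signs, so the halves below and above `Q` add up instead of cancelling; the
  -- omitted argument 0 costs bucket 0 one unit.
  c-value : ∀ t → c t ≡ + 2 * occupancy (toℕ t) - δ Fin.zero t
  c-value t = begin
    c t ≡⟨ Σ-fold p+1≡2Q (λ h → ψ (toℕ t) h * ψ (toℕ t) h) ⟩
    Σ {Q} (λ j → ψ (toℕ t) (toℕ j) * ψ (toℕ t) (toℕ j) + ψ (toℕ t) (Q ℕ.+ toℕ j) * ψ (toℕ t) (Q ℕ.+ toℕ j)) - ψ (toℕ t) 0 * ψ (toℕ t) 0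
      ≡⟨ cong₂ _-_ (trans (Σ-cong doubled) (Σ-*ˡ (+ 2) λ j → hits (toℕ t) (toℕ j)))
           (trans (cong₂ _*_ (ψ-0 t) (ψ-0 t)) (𝟙-idem ⌊ Fin.zero ≟ t ⌋)) ⟩
    + 2 * occupancy (toℕ t) - δ Fin.zero t ∎
    where
    open ≡-Reasoning
    collect : ∀ a → a * a + (- a) * (- a) ≡ + 2 * (a * a)
    collect = solve-∀
    doubled : ∀ (j : Fin Q) → ψ (toℕ t) (toℕ j) * ψ (toℕ t) (toℕ j) + ψ (toℕ t) (Q ℕ.+ toℕ j) * ψ (toℕ t) (Q ℕ.+ toℕ j)
      ≡ + 2 * hits (toℕ t) (toℕ j)
    doubled j = trans (cong₂ (λ a b → a * a + b * b) (ψ-low (toℕ t) (Fin.toℕ<n j)) (ψ-high (toℕ t) (Fin.toℕ<n j)))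
      (trans (collect (hits (toℕ t) (toℕ j))) (cong (+ 2 *_) (𝟙-idem ⌊ bucket (toℕ j) ℕ.≟ toℕ t ⌋)))

  bucket<r : ∀ h → bucket h < r
  bucket<r h = ℕ.m<n*o⇒m/o<n (ℕ.*-monoʳ-< r (ℕ.m%n<n h Q))

  hits-total : ∀ h → Σ {r} (λ t → hits (toℕ t) h) ≡ 1ℤ
  hits-total h = trans (Σ-cong λ t → trans (𝟙-⇔ (bucket h ℕ.≟ toℕ t) (i ≟ t)
      (λ e → Fin.toℕ-injective (trans (Fin.toℕ-fromℕ< (bucket<r h)) e)) (λ e → trans (sym (Fin.toℕ-fromℕ< (bucket<r h))) (cong toℕ e)))
      (sym (ℤ.*-identityʳ (δ i t)))) (Σ-δ i λ _ → 1ℤ)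
    where
    i = Fin.fromℕ< (bucket<r h)

  sign-square : ∀ h → h < Q ℕ.+ Q → sign h * sign h ≡ 1ℤ
  sign-square h h<2Q with h ℕ.<? Q
  ... | yes h<Q = cong₂ _*_ (sign-low h<Q) (sign-low h<Q)
  ... | no h≮Q  = subst (λ h → sign h * sign h ≡ 1ℤ) (ℕ.m+[n∸m]≡n Q≤h) (cong₂ _*_ (sign-high h-Q<Q) (sign-high h-Q<Q))
    where
    Q≤h = ℕ.≮⇒≥ h≮Q
    h-Q<Q : h ∸ Q < Q
    h-Q<Q = ℕ.+-cancelˡ-< Q (h ∸ Q) Q (subst (_< Q ℕ.+ Q) (sym (ℕ.m+[n∸m]≡n Q≤h)) h<2Q)

  -- Every value lies in exactly one bucket and its sign squares to 1. This is why the terms with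
  -- `x = y` contribute exactly `F₂`, without randomness.
  K-diagonal : ∀ a → K a a ≡ 1ℤ
  K-diagonal a = trans (Σ-cong square) (hits-total h)
    where
    h = suc (toℕ a)
    regroup : ∀ a s → (a * s) * (a * s) ≡ (a * a) * (s * s)
    regroup = solve-∀
    square : ∀ t → φ t a * φ t a ≡ hits (toℕ t) h
    square t = trans (cong₂ _*_ (ψ-sign (toℕ t) h) (ψ-sign (toℕ t) h)) (trans (regroup (hits (toℕ t) h) (sign h))
      (trans (cong₂ _*_ (𝟙-idem ⌊ bucket h ℕ.≟ toℕ t ⌋) (sign-square h (subst (h <_) p+1≡2Q (ℕ.s≤s (Fin.toℕ<n a)))))
        (ℤ.*-identityʳ (hits (toℕ t) h))))

  K-sum≡1 : Σ² K ≡ 1ℤ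
  K-sum≡1 = trans K-sum (trans (Σ-cong λ t → trans (cong₂ _*_ (μ-value t) (μ-value t)) (square (δ Fin.zero t))) (Σ-δ Fin.zero (δ Fin.zero)))
    where
    square : ∀ a → (- a) * (- a) ≡ a * a
    square = solve-∀

  -- Only bucket 0 has nonzero `μ`, so of the weights `c t` only that of bucket 0 survives.
  path-value : Σ (λ a → Σ² λ b d → K a b * K a d) ≡ + 2 * occupancy 0 - 1ℤ
  path-value = trans K-path-sum (trans (Σ-cong λ t → trans (cong (λ m → c t * (m * m)) (μ-value t)) (square (c t) (δ Fin.zero t)))
    (trans (Σ-δ Fin.zero λ t → δ Fin.zero t * c t) (trans (ℤ.*-identityˡ (c Fin.zero)) (c-value Fin.zero))))
    where
    square : ∀ c a → c * ((- a) * (- a)) ≡ a * (a * c)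
    square = solve-∀

  square-value : Σ² (λ a b → K a b * K a b)
    ≡ + 4 * Σ {r} (λ t → occupancy (toℕ t) * occupancy (toℕ t)) - + 4 * occupancy 0 + 1ℤ
  square-value = begin
    Σ² (λ a b → K a b * K a b)
      ≡⟨ trans K-square-sum (Σ-cong λ t → trans (cong₂ _*_ (c-value t) (c-value t)) (expand (occupancy (toℕ t)) (δ Fin.zero t))) ⟩
    Σ (λ t → + 4 * (occupancy (toℕ t) * occupancy (toℕ t)) + δ Fin.zero t * (δ Fin.zero t - + 4 * occupancy (toℕ t)))
      ≡⟨ trans (Σ-+ {r} _ _) (cong₂ _+_ (Σ-*ˡ (+ 4) λ t → occupancy (toℕ t) * occupancy (toℕ t)) (Σ-δ Fin.zero λ t → δ Fin.zero t - + 4 * occupancy (toℕ t))) ⟩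
    + 4 * Σ {r} (λ t → occupancy (toℕ t) * occupancy (toℕ t)) + (1ℤ - + 4 * occupancy 0)
      ≡⟨ reorder (+ 4 * Σ {r} (λ t → occupancy (toℕ t) * occupancy (toℕ t))) (+ 4 * occupancy 0) ⟩
    + 4 * Σ {r} (λ t → occupancy (toℕ t) * occupancy (toℕ t)) - + 4 * occupancy 0 + 1ℤ ∎
    where
    open ≡-Reasoning
    expand : ∀ n d → (+ 2 * n - d) * (+ 2 * n - d) ≡ + 4 * (n * n) + d * (d - + 4 * n)
    expand = solve-∀
    reorder : ∀ a b → a + (1ℤ - b) ≡ a - b + 1ℤ
    reorder = solve-∀

  occupancy-total : Σ {r} (λ t → occupancy (toℕ t)) ≡ + Q
  occupancy-total = trans (Σ-swap λ t j → hits (toℕ t) (toℕ j))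
    (trans (Σ-cong λ j → hits-total (toℕ j)) (trans (Σ-const Q 1ℤ) (ℤ.*-identityʳ (+ Q))))

  -- This is the ceiling of `t Q / r`: for `t ≤ r` it is the number of residues whose bucket is
  -- below `t`. Adding `r′ = r - 1` before dividing rounds up.
  boundary : ℕ → ℕ
  boundary t = (t ℕ.* Q ℕ.+ r′) / r

  boundary-upper : ∀ t → boundary t ℕ.* r ≤ t ℕ.* Q ℕ.+ r′
  boundary-upper t = ℕ.m/n*n≤m (t ℕ.* Q ℕ.+ r′) r

  boundary-lower : ∀ t → t ℕ.* Q ≤ boundary t ℕ.* r
  boundary-lower t = ℕ.+-cancelʳ-≤ r′ (t ℕ.* Q) (boundary t ℕ.* r) (begin
    t ℕ.* Q ℕ.+ r′                                             ≡⟨ ℕ.m≡m%n+[m/n]*n (t ℕ.* Q ℕ.+ r′) r ⟩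
    (t ℕ.* Q ℕ.+ r′) % r ℕ.+ boundary t ℕ.* r                  ≤⟨ ℕ.+-monoˡ-≤ (boundary t ℕ.* r) (ℕ.s≤s⁻¹ (ℕ.m%n<n (t ℕ.* Q ℕ.+ r′) r)) ⟩
    r′ ℕ.+ boundary t ℕ.* r                                    ≡⟨ ℕ.+-comm r′ (boundary t ℕ.* r) ⟩
    boundary t ℕ.* r ℕ.+ r′                                    ∎)
    where open ℕ.≤-Reasoning

  below-boundary : ∀ t {j} → j < boundary t → r ℕ.* j < t ℕ.* Q
  below-boundary t {j} j<L = ℕ.+-cancelʳ-< r′ (r ℕ.* j) (t ℕ.* Q) (begin
    suc (r ℕ.* j ℕ.+ r′)     ≡⟨ trans (cong (λ x → suc (x ℕ.+ r′)) (ℕ.*-comm r j)) (cong suc (ℕ.+-comm (j ℕ.* r) r′)) ⟩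
    suc j ℕ.* r              ≤⟨ ℕ.*-monoˡ-≤ r j<L ⟩
    boundary t ℕ.* r         ≤⟨ boundary-upper t ⟩
    t ℕ.* Q ℕ.+ r′           ∎)
    where open ℕ.≤-Reasoning

  below-boundary⁻¹ : ∀ t {j} → r ℕ.* j < t ℕ.* Q → j < boundary t
  below-boundary⁻¹ t {j} lt = ℕ.*-cancelˡ-< r j (boundary t)
    (ℕ.<-≤-trans lt (subst (t ℕ.* Q ≤_) (ℕ.*-comm (boundary t) r) (boundary-lower t)))

  boundary≤Q : ∀ {t} → t ≤ r → boundary t ≤ Q
  boundary≤Q {t} t≤r = ℕ.≮⇒≥ λ Q<L → ℕ.<⇒≱ (below-boundary t Q<L) (ℕ.*-monoˡ-≤ Q t≤r)

  -- `[i = t] = [i < t + 1] - [i < t]`, and the bucket of `j` is below `t` exactly when `j` is below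
  -- `boundary t`. Occupancy thus becomes a difference of two initial segments.
  hits-difference : ∀ t {j} → j < Q → hits t j ≡ 𝟙 ⌊ j ℕ.<? boundary (suc t) ⌋ - 𝟙 ⌊ j ℕ.<? boundary t ⌋
  hits-difference t {j} j<Q = trans (trans (cong (λ i → 𝟙 ⌊ i ℕ.≟ t ⌋) (cong (λ k → (r ℕ.* k) / Q) (ℕ.m<n⇒m%n≡m j<Q))) (equal-as-less i t))
      (cong₂ _-_ (threshold (suc t)) (threshold t))
    where
    i = (r ℕ.* j) / Q
    equal-as-less : ∀ i t → 𝟙 ⌊ i ℕ.≟ t ⌋ ≡ 𝟙 ⌊ i ℕ.<? suc t ⌋ - 𝟙 ⌊ i ℕ.<? t ⌋
    equal-as-less i t with ℕ.<-cmp i t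
    ... | tri< lt ne _ = trans (𝟙-no (i ℕ.≟ t) ne) (sym (cong₂ _-_ (𝟙-yes (i ℕ.<? suc t) (ℕ.m<n⇒m<1+n lt)) (𝟙-yes (i ℕ.<? t) lt)))
    ... | tri≈ nlt eq _ = trans (𝟙-yes (i ℕ.≟ t) eq) (sym (cong₂ _-_ (𝟙-yes (i ℕ.<? suc t) (ℕ.s≤s (ℕ.≤-reflexive eq))) (𝟙-no (i ℕ.<? t) nlt)))
    ... | tri> nlt ne gt = trans (𝟙-no (i ℕ.≟ t) ne) (sym (cong₂ _-_ (𝟙-no (i ℕ.<? suc t) (ℕ.≤⇒≯ gt)) (𝟙-no (i ℕ.<? t) nlt)))
    threshold : ∀ t → 𝟙 ⌊ i ℕ.<? t ⌋ ≡ 𝟙 ⌊ j ℕ.<? boundary t ⌋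
    threshold t = 𝟙-⇔ (i ℕ.<? t) (j ℕ.<? boundary t)
      (λ i<t → below-boundary⁻¹ t (ℕ.≰⇒> λ le → ℕ.<⇒≱ i<t (subst (_≤ i) (ℕ.m*n/n≡m t Q) (ℕ./-monoˡ-≤ Q le))))
      (λ j<L → ℕ.m<n*o⇒m/o<n (below-boundary t j<L))

  occupancy-value : ∀ t → t < r → occupancy t ≡ + boundary (suc t) - + boundary t
  occupancy-value t t<r = begin
    occupancy t ≡⟨ Σ-cong (λ j → hits-difference t (Fin.toℕ<n j)) ⟩
    Σ {Q} (λ j → 𝟙 ⌊ toℕ j ℕ.<? boundary (suc t) ⌋ - 𝟙 ⌊ toℕ j ℕ.<? boundary t ⌋) ≡⟨ Σ-- {Q} _ _ ⟩
    Σ {Q} (λ j → 𝟙 ⌊ toℕ j ℕ.<? boundary (suc t) ⌋) - Σ {Q} (λ j → 𝟙 ⌊ toℕ j ℕ.<? boundary t ⌋)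
      ≡⟨ cong₂ _-_ (Σ-initial (boundary (suc t)) (boundary≤Q t<r)) (Σ-initial (boundary t) (boundary≤Q (ℕ.<⇒≤ t<r))) ⟩
    + boundary (suc t) - + boundary t ∎
    where open ≡-Reasoning

-- Bucket sizes

pos-*+ : ∀ a b c → + (a ℕ.* b ℕ.+ c) ≡ + a * + b + + c
pos-*+ a b c = trans (ℤ.pos-+ (a ℕ.* b) c) (cong (_+ + c) (ℤ.pos-* a b))

-- An integer above -1 is nonnegative. The factor `r` lets rounding bounds with error at most
-- `r - 1` be sharpened to integers without dividing.
>-1⇒nonneg : ∀ {r z} → 0ℤ ℤ.≤ r → 0ℤ ℤ.≤ r * (z + 1ℤ) - 1ℤ → 0ℤ ℤ.≤ z
>-1⇒nonneg {r} {z} r≥0 h = subst (0ℤ ℤ.≤_) (cancel z) (ℤ.i≤j⇒0≤j-i (ℤ.i<j⇒suc[i]≤j 0<z+1))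
  where
  cancel : ∀ z → z + 1ℤ - 1ℤ ≡ z
  cancel = solve-∀
  0<z+1 : 0ℤ ℤ.< z + 1ℤ
  0<z+1 = ℤ.*-cancelˡ-<-nonNeg r {{ℤ.nonNegative r≥0}} (subst (ℤ._< r * (z + 1ℤ)) (sym (ℤ.*-zeroʳ r))
    (ℤ.<-≤-trans (ℤ.+<+ (ℕ.z<s {0})) (ℤ.0≤i-j⇒j≤i h)))

module Occupancy (Q r′ p : ℕ) {{_ : NonZero Q}} (p+1≡2Q : suc p ≡ Q ℕ.+ Q) where

  open Sketch Q r′ p p+1≡2Q

  private
    ρ : ℤ
    ρ = + r

  boundary-upperℤ : ∀ t → + boundary t * ρ ℤ.≤ + t * + Q + + r′
  boundary-upperℤ t = subst₂ ℤ._≤_ (ℤ.pos-* (boundary t) r) (pos-*+ t Q r′) (ℤ.+≤+ (boundary-upper t))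

  boundary-lowerℤ : ∀ t → + t * + Q ℤ.≤ + boundary t * ρ
  boundary-lowerℤ t = subst₂ ℤ._≤_ (ℤ.pos-* t Q) (ℤ.pos-* (boundary t) r) (ℤ.+≤+ (boundary-lower t))

  -- Upper rounding at the right end of the bucket and lower rounding at the left end combine to a
  -- total error of `r - 1`.
  occupancy-upper : ∀ t → t < r → 0ℤ ℤ.≤ + Q + + r′ - ρ * occupancy t
  occupancy-upper t t<r = subst (0ℤ ℤ.≤_) (trans (e (+ t) (+ Q) (+ r′) (+ boundary (suc t)) (+ boundary t) ρ)
      (cong (λ ν → + Q + + r′ - ρ * ν) (sym (occupancy-value t t<r))))
    (+-nonneg (ℤ.i≤j⇒0≤j-i (boundary-upperℤ (suc t))) (ℤ.i≤j⇒0≤j-i (boundary-lowerℤ t)))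
    where
    e : ∀ t Q r′ L′ L ρ → (1ℤ + t) * Q + r′ - L′ * ρ + (L * ρ - t * Q) ≡ Q + r′ - ρ * (L′ - L)
    e = solve-∀

  occupancy-lower : ∀ t → t < r → 0ℤ ℤ.≤ ρ * occupancy t - (+ Q - + r′)
  occupancy-lower t t<r = subst (0ℤ ℤ.≤_) (trans (e (+ t) (+ Q) (+ r′) (+ boundary (suc t)) (+ boundary t) ρ)
      (cong (λ ν → ρ * ν - (+ Q - + r′)) (sym (occupancy-value t t<r))))
    (+-nonneg (ℤ.i≤j⇒0≤j-i (boundary-lowerℤ (suc t))) (ℤ.i≤j⇒0≤j-i (boundary-upperℤ t)))
    where
    e : ∀ t Q r′ L′ L ρ → L′ * ρ - (1ℤ + t) * Q + (t * Q + r′ - L * ρ) ≡ ρ * (L′ - L) - (Q - r′)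
    e = solve-∀

  -- `boundary 0` is exactly 0, so the rounding loss `r - 1` of `occupancy-lower` disappears for the
  -- first bucket.
  occupancy-0-lower : 0ℤ ℤ.≤ ρ * occupancy 0 - + Q
  occupancy-0-lower = subst (λ ν → 0ℤ ℤ.≤ ρ * ν - + Q) (sym value)
      (subst (0ℤ ℤ.≤_) (e (+ boundary 1) ρ (+ Q)) (ℤ.i≤j⇒0≤j-i (boundary-lowerℤ 1)))
    where
    value : occupancy 0 ≡ + boundary 1 - 0ℤ
    value = trans (occupancy-value 0 ℕ.z<s) (cong (λ b → + boundary 1 - + b) (ℕ.m<n⇒m/n≡0 (ℕ.n<1+n r′)))
    e : ∀ L ρ Q → L * ρ - 1ℤ * Q ≡ ρ * (L - 0ℤ) - Q
    e = solve-∀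

  base : ℤ
  base = + (Q / r)

  -- Every occupancy is ⌊Q/r⌋ or ⌊Q/r⌋ + 1.
  occupancy-two-valued : ∀ t → t < r → 0ℤ ℤ.≤ (occupancy t - base) * (1ℤ - (occupancy t - base))
  occupancy-two-valued t t<r = *-nonneg
      {ν - base} {1ℤ - (ν - base)}
      (>-1⇒nonneg {z = ν - base} ρ≥0 (subst (0ℤ ℤ.≤_) (e₁ ν (+ Q) (+ r′) base (+ (Q % r)) division)
        (+-nonneg (occupancy-lower t t<r) (ℤ.+≤+ ℕ.z≤n))))
      (>-1⇒nonneg {z = 1ℤ - (ν - base)} ρ≥0 (subst (0ℤ ℤ.≤_) (e₂ ν (+ Q) (+ r′) base (+ (Q % r)) division)
        (+-nonneg (+-nonneg (occupancy-upper t t<r) (ℤ.i≤j⇒0≤j-i (ℤ.+≤+ (ℕ.s≤s⁻¹ (ℕ.m%n<n Q r))))) (ℤ.+≤+ (ℕ.z≤n {1})))))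
    where
    ν = occupancy t
    ρ≥0 : 0ℤ ℤ.≤ ρ
    ρ≥0 = ℤ.+≤+ ℕ.z≤n
    division : + Q ≡ + (Q % r) + base * ρ
    division = trans (cong +_ (ℕ.m≡m%n+[m/n]*n Q r)) (trans (ℤ.pos-+ (Q % r) (Q / r ℕ.* r)) (cong (_+_ (+ (Q % r))) (ℤ.pos-* (Q / r) r)))
    e₁ : ∀ ν Q r′ base x → Q ≡ x + base * (1ℤ + r′) → (1ℤ + r′) * ν - (Q - r′) + x ≡ (1ℤ + r′) * (ν - base + 1ℤ) - 1ℤ
    e₁ ν _ r′ base x refl = f ν r′ base x
      where f : ∀ ν r′ base x → (1ℤ + r′) * ν - (x + base * (1ℤ + r′) - r′) + x ≡ (1ℤ + r′) * (ν - base + 1ℤ) - 1ℤ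
            f = solve-∀
    e₂ : ∀ ν Q r′ base x → Q ≡ x + base * (1ℤ + r′) → Q + r′ - (1ℤ + r′) * ν + (r′ - x) + 1ℤ ≡ (1ℤ + r′) * (1ℤ - (ν - base) + 1ℤ) - 1ℤ
    e₂ ν _ r′ base x refl = f ν r′ base x
      where f : ∀ ν r′ base x → x + base * (1ℤ + r′) + r′ - (1ℤ + r′) * ν + (r′ - x) + 1ℤ ≡ (1ℤ + r′) * (1ℤ - (ν - base) + 1ℤ) - 1ℤ
            f = solve-∀

  squares : ℤ
  squares = Σ {r} λ t → occupancy (toℕ t) * occupancy (toℕ t)

  -- Numbers confined to two consecutive integers have variance at most 1/4. Summing the two-valued
  -- inequality bounds `squares` in terms of `base`; completing the square removes `base`, with
  -- remainder `(2 Q - (2 base + 1) r)²`.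
  squares-upper : ρ * (+ 4 * squares) ℤ.≤ (+ Q + + Q) * (+ Q + + Q) + ρ * ρ
  squares-upper = ≤-from-nonneg (e ρ squares (+ Q) base)
      (+-nonneg (*-nonneg (ℤ.+≤+ (ℕ.z≤n {4 ℕ.* r})) gap) (square-nonneg (+ 2 * + Q - (+ 2 * base + 1ℤ) * ρ)))
    where
    open ≡-Reasoning
    expand : ∀ ν base → (ν - base) * (1ℤ - (ν - base)) ≡ (+ 2 * base + 1ℤ) * ν + (- 1ℤ) * (ν * ν) - base * (base + 1ℤ)
    expand = solve-∀
    total : Σ {r} (λ t → (occupancy (toℕ t) - base) * (1ℤ - (occupancy (toℕ t) - base)))
      ≡ (+ 2 * base + 1ℤ) * + Q + (- 1ℤ) * squares - ρ * (base * (base + 1ℤ))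
    total = begin
      Σ {r} (λ t → (occupancy (toℕ t) - base) * (1ℤ - (occupancy (toℕ t) - base)))
        ≡⟨ Σ-cong (λ t → expand (occupancy (toℕ t)) base) ⟩
      Σ {r} (λ t → (+ 2 * base + 1ℤ) * occupancy (toℕ t) + (- 1ℤ) * (occupancy (toℕ t) * occupancy (toℕ t)) - base * (base + 1ℤ))
        ≡⟨ Σ-- {r} _ (λ _ → base * (base + 1ℤ)) ⟩
      Σ {r} (λ t → (+ 2 * base + 1ℤ) * occupancy (toℕ t) + (- 1ℤ) * (occupancy (toℕ t) * occupancy (toℕ t))) - Σ {r} (λ _ → base * (base + 1ℤ))
        ≡⟨ cong₂ _-_ (trans (Σ-lin (+ 2 * base + 1ℤ) (- 1ℤ) (λ t → occupancy (toℕ t)) (λ t → occupancy (toℕ t) * occupancy (toℕ t)))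
             (cong (λ s → (+ 2 * base + 1ℤ) * s + (- 1ℤ) * squares) occupancy-total)) (Σ-const r (base * (base + 1ℤ))) ⟩
      (+ 2 * base + 1ℤ) * + Q + (- 1ℤ) * squares - ρ * (base * (base + 1ℤ)) ∎
    gap : 0ℤ ℤ.≤ (+ 2 * base + 1ℤ) * + Q + (- 1ℤ) * squares - ρ * (base * (base + 1ℤ))
    gap = subst (0ℤ ℤ.≤_) total (Σ-nonneg λ t → occupancy-two-valued (toℕ t) (Fin.toℕ<n t))
    e : ∀ ρ s Q base → (Q + Q) * (Q + Q) + ρ * ρ - ρ * (+ 4 * s)
      ≡ + 4 * ρ * ((+ 2 * base + 1ℤ) * Q + (- 1ℤ) * s - ρ * (base * (base + 1ℤ))) + (+ 2 * Q - (+ 2 * base + 1ℤ) * ρ) * (+ 2 * Q - (+ 2 * base + 1ℤ) * ρ)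
    e = solve-∀

  q-value : 1ℤ + + p ≡ + Q + + Q
  q-value = trans (cong +_ p+1≡2Q) (ℤ.pos-+ Q Q)

  collision-bound : ρ * Σ² (λ a b → K a b * K a b)
    ℤ.≤ (1ℤ + + p) * (1ℤ + + p) + ρ * ρ - + 4 * (ρ * occupancy 0) + ρ
  collision-bound = subst₂ (λ s q → ρ * s ℤ.≤ q * q + ρ * ρ - + 4 * (ρ * occupancy 0) + ρ) (sym square-value) (sym q-value)
      (≤-from-nonneg (e ρ squares (occupancy 0) (+ Q)) (ℤ.i≤j⇒0≤j-i squares-upper))
    where
    e : ∀ ρ s ν Q → (Q + Q) * (Q + Q) + ρ * ρ - + 4 * (ρ * ν) + ρ - ρ * (+ 4 * s - + 4 * ν + 1ℤ)
      ≡ (Q + Q) * (Q + Q) + ρ * ρ - ρ * (+ 4 * s)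
    e = solve-∀

  occupancy-0-large : 0ℤ ℤ.≤ + 2 * (ρ * occupancy 0) - (1ℤ + + p)
  occupancy-0-large = subst (λ q → 0ℤ ℤ.≤ + 2 * (ρ * occupancy 0) - q) (sym q-value)
      (subst (0ℤ ℤ.≤_) (e ρ (occupancy 0) (+ Q)) (*-nonneg {+ 2} (ℤ.+≤+ ℕ.z≤n) occupancy-0-lower))
    where
    e : ∀ ρ ν Q → + 2 * (ρ * ν - Q) ≡ + 2 * (ρ * ν) - (Q + Q)
    e = solve-∀

  occupancy-0-positive : 0ℤ ℤ.≤ occupancy 0 - 1ℤ
  occupancy-0-positive = >-1⇒nonneg {ρ} (ℤ.+≤+ ℕ.z≤n) (subst (0ℤ ℤ.≤_) (e ρ (occupancy 0) (+ Q))
      (+-nonneg occupancy-0-lower (ℤ.i≤j⇒0≤j-i (ℤ.+≤+ 0<Q))))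
    where
    e : ∀ ρ ν Q → ρ * ν - Q + (Q - 1ℤ) ≡ ρ * (ν - 1ℤ + 1ℤ) - 1ℤ
    e = solve-∀

-- The bias

module Support {u : ℕ} (f : Fin u → ℤ) where

  open OffDiagonal f

  support : Fin u → ℤ
  support x = 𝟙 (if ⌊ f x ℤ.≟ + 0 ⌋ then false else true)

  ν : ℤ
  ν = + nnz f

  support-total : Σ support ≡ ν
  support-total = Σ-𝟙 λ x → if ⌊ f x ℤ.≟ + 0 ⌋ then false else true

  support-nonneg : ∀ x → 0ℤ ℤ.≤ support x
  support-nonneg x with f x ℤ.≟ + 0
  ... | yes _ = ℤ.+≤+ ℕ.z≤n
  ... | no _  = ℤ.+≤+ ℕ.z≤n

  support-* : ∀ x → support x * f x ≡ f x
  support-* x with f x ℤ.≟ + 0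
  ... | yes e = trans (ℤ.*-zeroˡ (f x)) (sym e)
  ... | no _  = ℤ.*-identityˡ (f x)

  support-square : ∀ x → support x * (f x * f x) ≡ f x * f x
  support-square x = trans (sym (ℤ.*-assoc (support x) (f x) (f x))) (cong (_* f x) (support-* x))

  support≤square : ∀ x → support x ℤ.≤ f x * f x
  support≤square x with f x ℤ.≟ + 0
  ... | yes _ = square-nonneg (f x)
  ... | no ne = positive (f x) ne
    where
    positive : ∀ a → a ≢ 0ℤ → 1ℤ ℤ.≤ a * a
    positive (+ zero)       ne = ⊥-elim (ne refl)
    positive (+ suc a)      ne = ℤ.+≤+ (ℕ.s≤s ℕ.z≤n)
    positive (ℤ.-[1+ a ])   ne = ℤ.+≤+ (ℕ.s≤s ℕ.z≤n)

  -- A nonzero integer has square at least 1; a nonempty support therefore makes `F₂` positive.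
  n≤F₂ : ν ℤ.≤ F₂
  n≤F₂ = subst (ℤ._≤ F₂) support-total (Σ-mono support≤square)

  -- Twice the right-hand expression is the sum of `(f x + ε f y)²` over ordered pairs of distinct
  -- keys in the support. Weighting by the support puts `n - 1` where all keys would give `u - 1`.
  off-diagonal-bound : ∀ ε → ε * ε ≡ 1ℤ → 0ℤ ℤ.≤ F₂ * (ν - 1ℤ) + ε * T
  off-diagonal-bound ε ε² = half-nonneg (subst (0ℤ ℤ.≤_) value
      (Σ-nonneg λ x → Σ-nonneg λ y → *-nonneg (off-nonneg x y) (*-nonneg (*-nonneg (support-nonneg x) (support-nonneg y)) (square-nonneg (f x + ε * f y)))))
    where
    open ≡-Reasoning
    Q : Fin u → Fin u → ℤ
    Q x y = (support x * support y) * ((f x + ε * f y) * (f x + ε * f y))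
    diagonal : ∀ x → Q x x ≡ (+ 2 + + 2 * ε) * (f x * f x)
    diagonal x = trans (expand (support x) (f x) ε) (trans (cong₂ (λ s e → s * s * (1ℤ + + 2 * ε + e)) (support-* x) ε²) (collect (f x) ε))
      where
      expand : ∀ w a e → (w * w) * ((a + e * a) * (a + e * a)) ≡ (w * a) * (w * a) * (1ℤ + + 2 * e + e * e)
      expand = solve-∀
      collect : ∀ a e → a * a * (1ℤ + + 2 * e + 1ℤ) ≡ (+ 2 + + 2 * e) * (a * a)
      collect = solve-∀
    finish : ∀ ν F T e → + 2 * (ν * F + e * T) - (+ 2 + + 2 * e) * F ≡ + 2 * (F * (ν - 1ℤ) + e * (T - F))
    finish = solve-∀
    value : Σ² (λ x y → off x y * Q x y) ≡ + 2 * (F₂ * (ν - 1ℤ) + ε * T)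
    value = begin
      Σ² (λ x y → off x y * Q x y)
        ≡⟨ Σ-cong (λ x → Σ-off x (Q x)) ⟩
      Σ (λ x → Σ (Q x) - Q x x)
        ≡⟨ Σ-- (λ x → Σ (Q x)) (λ x → Q x x) ⟩
      Σ² Q - Σ (λ x → Q x x)
        ≡⟨ cong₂ _-_ (trans (Σ-pair-square support f ε ε²)
             (cong₂ (λ a b → + 2 * (Σ support * a + ε * (b * b))) (Σ-cong support-square) (Σ-cong support-*)))
             (trans (Σ-cong diagonal) (Σ-*ˡ (+ 2 + + 2 * ε) λ x → f x * f x)) ⟩
      + 2 * (Σ support * F₂ + ε * (F₁ * F₁)) - (+ 2 + + 2 * ε) * F₂
        ≡⟨ finish (Σ support) F₂ (F₁ * F₁) ε ⟩
      + 2 * (F₂ * (Σ support - 1ℤ) + ε * (F₁ * F₁ - F₂))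
        ≡⟨ cong₂ (λ s t → + 2 * (F₂ * (s - 1ℤ) + ε * t)) support-total (sym T-value) ⟩
      + 2 * (F₂ * (ν - 1ℤ) + ε * T) ∎

  ∣T∣-bound : + ℤ.∣ T ∣ ℤ.≤ F₂ * (ν - 1ℤ)
  ∣T∣-bound = cases T (off-diagonal-bound 1ℤ refl) (off-diagonal-bound (- 1ℤ) refl)
    where
    neg : ∀ B t → B - t ≡ B + - 1ℤ * t
    neg = solve-∀
    pos : ∀ B t → B - (- t) ≡ B + 1ℤ * t
    pos = solve-∀
    cases : ∀ {B} t → 0ℤ ℤ.≤ B + 1ℤ * t → 0ℤ ℤ.≤ B + - 1ℤ * t → + ℤ.∣ t ∣ ℤ.≤ B
    cases {B} (+ t)        _ h = ≤-from-nonneg (neg B (+ t)) h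
    cases {B} (ℤ.-[1+ t ]) h _ = ≤-from-nonneg (pos B ℤ.-[1+ t ]) h

-- Fractions

-- Reduced fractions hide their original numerators, so comparisons pass through unnormalised
-- rationals, where they are cross multiplication.
/-cross : ∀ {a b m n} .{{_ : NonZero m}} .{{_ : NonZero n}} → a * + n ≡ b * + m → a ℚ./ m ≡ b ℚ./ n
/-cross {a} {b} {suc m} {suc n} e = ℚ.fromℚᵘ-cong {mkℚᵘ a m} {mkℚᵘ b n} (*≡* e)

/-cross-≤ : ∀ {a b m n} .{{_ : NonZero m}} .{{_ : NonZero n}} → a * + n ℤ.≤ b * + m → a ℚ./ m ℚ.≤ b ℚ./ n
/-cross-≤ {a} {b} {suc m} {suc n} e = ℚ.toℚᵘ-cancel-≤ (ℚᵘ.≤-trans (ℚᵘ.≤-reflexive (ℚ.toℚᵘ-fromℚᵘ (mkℚᵘ a m)))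
  (ℚᵘ.≤-trans (*≤* e) (ℚᵘ.≤-reflexive (ℚᵘ.≃-sym (ℚ.toℚᵘ-fromℚᵘ (mkℚᵘ b n))))))

/-cross-< : ∀ {a b m n} .{{_ : NonZero m}} .{{_ : NonZero n}} → a * + n ℤ.< b * + m → a ℚ./ m ℚ.< b ℚ./ n
/-cross-< {a} {b} {suc m} {suc n} e = ℚ.toℚᵘ-cancel-< (ℚᵘ.<-respˡ-≃ (ℚᵘ.≃-sym (ℚ.toℚᵘ-fromℚᵘ (mkℚᵘ a m)))
  (ℚᵘ.<-respʳ-≃ (ℚᵘ.≃-sym (ℚ.toℚᵘ-fromℚᵘ (mkℚᵘ b n))) (*<* e)))

/-* : ∀ a b m n → (a ℚ./ suc m) ℚ.* (b ℚ./ suc n) ≡ (a * b) ℚ./ (suc m ℕ.* suc n)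
/-* a b m n = ℚ.toℚᵘ-injective (ℚᵘ.≃-trans (ℚ.toℚᵘ-homo-* (a ℚ./ suc m) (b ℚ./ suc n))
  (ℚᵘ.≃-trans (ℚᵘ.*-cong (ℚ.toℚᵘ-fromℚᵘ (mkℚᵘ a m)) (ℚ.toℚᵘ-fromℚᵘ (mkℚᵘ b n)))
    (ℚᵘ.≃-sym (ℚ.toℚᵘ-fromℚᵘ (mkℚᵘ a m ℚᵘ.* mkℚᵘ b n)))))

/-+ : ∀ a b m n → (a ℚ./ suc m) ℚ.+ (b ℚ./ suc n) ≡ (a * + suc n + b * + suc m) ℚ./ (suc m ℕ.* suc n)
/-+ a b m n = ℚ.toℚᵘ-injective (ℚᵘ.≃-trans (ℚ.toℚᵘ-homo-+ (a ℚ./ suc m) (b ℚ./ suc n))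
  (ℚᵘ.≃-trans (ℚᵘ.+-cong (ℚ.toℚᵘ-fromℚᵘ (mkℚᵘ a m)) (ℚ.toℚᵘ-fromℚᵘ (mkℚᵘ b n)))
    (ℚᵘ.≃-sym (ℚ.toℚᵘ-fromℚᵘ (mkℚᵘ a m ℚᵘ.+ mkℚᵘ b n)))))

neg-/ : ∀ a m → ℚ.- (a ℚ./ suc m) ≡ (- a) ℚ./ suc m
neg-/ a m = ℚ.toℚᵘ-injective (ℚᵘ.≃-trans (ℚ.toℚᵘ-homo‿- (a ℚ./ suc m))
  (ℚᵘ.≃-trans (ℚᵘ.-‿cong (ℚ.toℚᵘ-fromℚᵘ (mkℚᵘ a m))) (ℚᵘ.≃-sym (ℚ.toℚᵘ-fromℚᵘ (mkℚᵘ (- a) m)))))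

∣/∣ : ∀ a m → ℚ.∣ a ℚ./ suc m ∣ ≡ + ℤ.∣ a ∣ ℚ./ suc m
∣/∣ a m = ℚ.toℚᵘ-injective (ℚᵘ.≃-trans (ℚ.toℚᵘ-homo-∣-∣ (a ℚ./ suc m))
  (ℚᵘ.≃-trans (ℚᵘ.∣-∣-cong (ℚ.toℚᵘ-fromℚᵘ (mkℚᵘ a m))) (ℚᵘ.≃-sym (ℚ.toℚᵘ-fromℚᵘ (mkℚᵘ (+ ℤ.∣ a ∣) m)))))

toℚ-* : ∀ a b m → toℚ a ℚ.* (b ℚ./ suc m) ≡ (a * b) ℚ./ suc m
toℚ-* a b m = trans (/-* a b 0 m) (/-cross {a * b} {a * b} {suc (m ℕ.+ 0)} (cong (λ k → a * b * + suc k) (sym (ℕ.+-identityʳ m))))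

*-toℚ : ∀ a b m → (b ℚ./ suc m) ℚ.* toℚ a ≡ (b * a) ℚ./ suc m
*-toℚ a b m = trans (ℚ.*-comm (b ℚ./ suc m) (toℚ a)) (trans (toℚ-* a b m) (cong (λ z → z ℚ./ suc m) (ℤ.*-comm a b)))

toℚ-+ : ∀ a b m → toℚ a ℚ.+ (b ℚ./ suc m) ≡ (a * + suc m + b) ℚ./ suc m
toℚ-+ a b m = trans (/-+ a b 0 m) (trans (cong (λ z → (a * + suc m + z) ℚ./ suc (m ℕ.+ 0)) (ℤ.*-identityʳ b))
  (/-cross {a * + suc m + b} {a * + suc m + b} {suc (m ℕ.+ 0)} (cong (λ k → (a * + suc m + b) * + suc k) (sym (ℕ.+-identityʳ m)))))

toℚ-- : ∀ a b m → toℚ a ℚ.- (b ℚ./ suc m) ≡ (a * + suc m - b) ℚ./ suc m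
toℚ-- a b m = trans (cong (toℚ a ℚ.+_) (neg-/ b m)) (toℚ-+ a (- b) m)

toℚ-÷ : ∀ a n .{{_ : NonZero n}} → toℚ a ÷ℕ n ≡ a ℚ./ n
toℚ-÷ a (suc d) = trans (toℚ-* a 1ℤ d) (cong (λ z → z ℚ./ suc d) (ℤ.*-identityʳ a))

/-÷ : ∀ a m n → (a ℚ./ suc m) ÷ℕ suc n ≡ a ℚ./ (suc m ℕ.* suc n)
/-÷ a m n = trans (/-* a 1ℤ m n) (cong (λ z → z ℚ./ (suc m ℕ.* suc n)) (ℤ.*-identityʳ a))

/-add : ∀ a b m → (a ℚ./ suc m) ℚ.+ (b ℚ./ suc m) ≡ (a + b) ℚ./ suc m
/-add a b m = trans (/-+ a b m m) (/-cross {a * + suc m + b * + suc m} {a + b} {suc m ℕ.* suc m}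
  (trans (collect a b (+ suc m)) (cong ((a + b) *_) (sym (ℤ.pos-* (suc m) (suc m))))))
  where
  collect : ∀ a b d → (a * d + b * d) * d ≡ (a + b) * (d * d)
  collect = solve-∀

Σℚ-cong : {f g : Fin n → ℚ} → (∀ i → f i ≡ g i) → Σℚ f ≡ Σℚ g
Σℚ-cong {zero}  e = refl
Σℚ-cong {suc n} e = cong₂ ℚ._+_ (e Fin.zero) (Σℚ-cong λ i → e (Fin.suc i))

Σℚ-/ : (m : ℕ) (z : Fin n → ℤ) → Σℚ (λ i → z i ℚ./ suc m) ≡ Σ z ℚ./ suc m
Σℚ-/ {zero}  m z = trans (sym (ℚ.0/n≡0 (suc m))) (cong (λ s → s ℚ./ suc m) (sym (Σ-[] z)))
Σℚ-/ {suc n} m z = trans (cong ((z Fin.zero ℚ./ suc m) ℚ.+_) (Σℚ-/ m λ i → z (Fin.suc i)))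
  (trans (/-add (z Fin.zero) (Σ λ i → z (Fin.suc i)) m) (cong (λ s → s ℚ./ suc m) (sym (Σ-∷ z))))

𝔼-/ : ∀ {M} d (z : Fin (suc M) → ℤ) → 𝔼 (λ k → z k ℚ./ suc d) ≡ Σ z ℚ./ (suc d ℕ.* suc M)
𝔼-/ {M} d z = trans (cong (ℚ._* (1ℤ ℚ./ suc M)) (Σℚ-/ d z)) (trans (/-* (Σ z) 1ℤ d M)
  (cong (λ s → s ℚ./ (suc d ℕ.* suc M)) (ℤ.*-identityʳ (Σ z))))

𝔼-toℚ : ∀ {M} (z : Fin (suc M) → ℤ) → 𝔼 (λ k → toℚ (z k)) ≡ Σ z ℚ./ suc M
𝔼-toℚ {M} z = trans (cong (ℚ._* (1ℤ ℚ./ suc M)) (Σℚ-/ 0 z)) (trans (toℚ-* (Σ z) 1ℤ M)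
  (cong (λ s → s ℚ./ suc M) (ℤ.*-identityʳ (Σ z))))

-- Each deviation has denominator `N`, its square `N²`, and averaging adds a third factor.
Var-toℚ : ∀ {M} (z : Fin (suc M) → ℤ) →
  Var (λ k → toℚ (z k)) ≡ Σ (λ k → (z k * + suc M - Σ z) * (z k * + suc M - Σ z)) ℚ./ (suc M ℕ.* suc M ℕ.* suc M)
Var-toℚ {M} z = trans (cong (ℚ._* (1ℤ ℚ./ suc M)) (Σℚ-cong deviation)) (𝔼-/ (M ℕ.+ M ℕ.* suc M) _)
  where
  deviation : ∀ k → (toℚ (z k) ℚ.- 𝔼 (λ k → toℚ (z k))) ℚ.* (toℚ (z k) ℚ.- 𝔼 (λ k → toℚ (z k)))
    ≡ ((z k * + suc M - Σ z) * (z k * + suc M - Σ z)) ℚ./ (suc M ℕ.* suc M)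
  deviation k = trans (cong (λ e → e ℚ.* e) (trans (cong (ℚ._-_ (toℚ (z k))) (𝔼-toℚ z)) (toℚ-- (z k) (Σ z) M)))
    (/-* (z k * + suc M - Σ z) (z k * + suc M - Σ z) M M)

-- The estimator

Fm-1 : ∀ {u} (f : Fin u → ℤ) → Fm 1 f ≡ Σ f
Fm-1 f = trans (Σ-def (λ x → f x ℤ.^ 1)) (Σ-cong λ x → ℤ.*-identityʳ (f x))

Fm-2 : ∀ {u} (f : Fin u → ℤ) → Fm 2 f ≡ Σ (λ x → f x * f x)
Fm-2 f = trans (Σ-def (λ x → f x ℤ.^ 2)) (Σ-cong λ x → cong (f x *_) (ℤ.*-identityʳ (f x)))

module Estimate (b r′ M u p₀ : ℕ) (p+1≡2Q : suc (suc p₀) ≡ 2 ^ (b ∸ 1) ℕ.+ 2 ^ (b ∸ 1))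
  (4≤u : 4 ≤ u) (H : Family M u (suc p₀)) (univ : FourUniversal H) (f : Fin u → ℤ) where

  open CountSketch b (suc r′) hiding (half-nz)

  private instance
    half-nonZero : NonZero half
    half-nonZero = CountSketch.half-nz b (suc r′)

  open Sketch half r′ (suc p₀) p+1≡2Q
  open Occupancy half r′ (suc p₀) p+1≡2Q using (occupancy-0-large; occupancy-0-positive; collision-bound)
  open OffDiagonal f
  open Moments H univ 4≤u K K-sym K-sum≡1 f renaming (c to c₀)

  open Universality H univ 4≤u using (P; N)
  open Support f

  C-value : ∀ (h : Fin u → Fin (suc p₀)) t → C h f t ≡ Σ λ x → φ t (h x) * f x
  C-value h t = trans (Σ-def (λ x → if ⌊ ix (h x) ℕ.≟ toℕ t ⌋ then sx (h x) * f x else + 0)) (Σ-cong λ x → factor (ix (h x) ℕ.≟ toℕ t) (sx (h x)) (f x))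
    where
    factor : ∀ {A : Set} (d : Dec A) s a → (if ⌊ d ⌋ then s * a else 0ℤ) ≡ (if ⌊ d ⌋ then s else 0ℤ) * a
    factor (yes _) s a = refl
    factor (no _)  s a = sym (ℤ.*-zeroˡ a)

  X-value : ∀ k → X (H k) f ≡ F₂ + Y k
  X-value k = begin
    X (H k) f
      ≡⟨ Σ-def (λ t → C (H k) f t * C (H k) f t) ⟩
    Σ (λ t → C (H k) f t * C (H k) f t)
      ≡⟨ Σ-cong (λ t → trans (cong₂ _*_ (C-value (H k) t) (C-value (H k) t)) (sym (Σ-prod (λ x → φ t (H k x) * f x) (λ y → φ t (H k y) * f y)))) ⟩
    Σ (λ t → Σ² λ x y → (φ t (H k x) * f x) * (φ t (H k y) * f y))
      ≡⟨ trans (Σ-swap λ t x → Σ λ y → (φ t (H k x) * f x) * (φ t (H k y) * f y))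
           (Σ-cong λ x → Σ-swap λ t y → (φ t (H k x) * f x) * (φ t (H k y) * f y)) ⟩
    Σ² (λ x y → Σ λ t → (φ t (H k x) * f x) * (φ t (H k y) * f y))
      ≡⟨ Σ²-cong (λ x y → trans (Σ-cong λ t → regroup (φ t (H k x)) (f x) (φ t (H k y)) (f y)) (Σ-*ˡ (f x * f y) λ t → φ t (H k x) * φ t (H k y))) ⟩
    Σ² (λ x y → (f x * f y) * κ k x y)
      ≡⟨ trans (Σ²-cong λ x y → separate (δ x y) (f x * f y) (κ k x y)) (Σ²-+ (λ x y → δ x y * ((f x * f y) * κ k x y)) (λ x y → G x y * κ k x y)) ⟩
    Σ² (λ x y → δ x y * ((f x * f y) * κ k x y)) + Y k
      -- On the diagonal the kernel is 1, so these terms reduce to `F₂`.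
      ≡⟨ cong (_+ Y k) (Σ-cong λ x → trans (Σ-δ x λ y → (f x * f y) * κ k x y)
           (trans (cong (f x * f x *_) (K-diagonal (H k x))) (ℤ.*-identityʳ (f x * f x)))) ⟩
    F₂ + Y k ∎
    where
    open ≡-Reasoning
    regroup : ∀ a b c d → (a * b) * (c * d) ≡ (b * d) * (a * c)
    regroup = solve-∀
    separate : ∀ d g k → g * k ≡ d * (g * k) + ((1ℤ - d) * g) * k
    separate = solve-∀

  X-sum : Σ (λ k → X (H k) f) ≡ N * F₂ + Σ Y
  X-sum = trans (Σ-cong X-value) (trans (Σ-+ (λ _ → F₂) Y) (cong (_+ Σ Y) (Σ-const (suc M) F₂)))

  off-diagonal-value : Fm 1 f * Fm 1 f - Fm 2 f ≡ T
  off-diagonal-value = trans (cong₂ (λ a b → a * a - b) (Fm-1 f) (Fm-2 f)) (sym T-value)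

  p : ℕ
  p = suc p₀

  p²-value : p ^ 2 ≡ p ℕ.* p
  p²-value = cong (p ℕ.*_) (ℕ.*-identityʳ p)

  ÷-p² : ∀ z → toℚ z ÷ℕ (p ^ 2) ≡ z ℚ./ (p ℕ.* p)
  ÷-p² z = trans (cong (toℚ z ÷ℕ_) p²-value) (toℚ-÷ z (p ℕ.* p))

  EX : ℚ
  EX = 𝔼 (λ k → toℚ (X (H k) f))

  mean : EX ≡ toℚ (Fm 2 f) ℚ.+ (toℚ (Fm 1 f * Fm 1 f - Fm 2 f) ÷ℕ (p ^ 2))
  mean = begin
    EX                                                 ≡⟨ 𝔼-toℚ (λ k → X (H k) f) ⟩
    Σ (λ k → X (H k) f) ℚ./ suc M                      ≡⟨ /-cross {Σ (λ k → X (H k) f)} {F₂ * + (p ℕ.* p) + T} {suc M} {p ℕ.* p} cross ⟩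
    (F₂ * + (p ℕ.* p) + T) ℚ./ (p ℕ.* p)               ≡⟨ toℚ-+ F₂ T (p₀ ℕ.+ p₀ ℕ.* p) ⟨
    toℚ F₂ ℚ.+ T ℚ./ (p ℕ.* p)                         ≡⟨ cong (toℚ F₂ ℚ.+_) (÷-p² T) ⟨
    toℚ F₂ ℚ.+ (toℚ T ÷ℕ (p ^ 2))                      ≡⟨ cong₂ (λ a t → toℚ a ℚ.+ (toℚ t ÷ℕ (p ^ 2))) (Fm-2 f) off-diagonal-value ⟨
    toℚ (Fm 2 f) ℚ.+ (toℚ (Fm 1 f * Fm 1 f - Fm 2 f) ÷ℕ (p ^ 2)) ∎
    where
    open ≡-Reasoning
    expand : ∀ n a s p → (n * a + s) * (p * p) ≡ n * a * (p * p) + p * p * s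
    expand = solve-∀
    collect : ∀ n a t p → n * a * (p * p) + n * t ≡ (a * (p * p) + t) * n
    collect = solve-∀
    cross : Σ (λ k → X (H k) f) * + (p ℕ.* p) ≡ (F₂ * + (p ℕ.* p) + T) * + suc M
    cross = begin
      Σ (λ k → X (H k) f) * + (p ℕ.* p)        ≡⟨ cong₂ _*_ X-sum (ℤ.pos-* p p) ⟩
      (N * F₂ + Σ Y) * (P * P)                 ≡⟨ expand N F₂ (Σ Y) P ⟩
      N * F₂ * (P * P) + P * P * Σ Y           ≡⟨ cong (_+_ (N * F₂ * (P * P))) first-moment ⟩
      N * F₂ * (P * P) + N * T                 ≡⟨ collect N F₂ T P ⟩
      (F₂ * (P * P) + T) * N                   ≡⟨ cong (λ d → (F₂ * d + T) * N) (ℤ.pos-* p p) ⟨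
      (F₂ * + (p ℕ.* p) + T) * + suc M         ∎

  bias : ℚ.∣ EX ℚ.- toℚ (Fm 2 f) ∣ ℚ.≤ (toℚ (Fm 2 f * (+ nnz f - + 1)) ÷ℕ (p ^ 2))
  bias = subst₂ ℚ._≤_ (sym left) (sym right) (/-cross-≤ {+ ℤ.∣ T ∣} {F₂ * (ν - 1ℤ)} {p ℕ.* p} {p ℕ.* p}
      (ℤ.*-monoʳ-≤-nonNeg (+ (p ℕ.* p)) ∣T∣-bound))
    where
    cancel : ∀ a c → (a ℚ.+ c) ℚ.- a ≡ c
    cancel a c = trans (cong (ℚ._- a) (ℚ.+-comm a c)) (trans (ℚ.+-assoc c a (ℚ.- a)) (trans (cong (c ℚ.+_) (ℚ.+-inverseʳ a)) (ℚ.+-identityʳ c)))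
    left : ℚ.∣ EX ℚ.- toℚ (Fm 2 f) ∣ ≡ + ℤ.∣ T ∣ ℚ./ (p ℕ.* p)
    left = trans (cong ℚ.∣_∣ (trans (cong (ℚ._- toℚ (Fm 2 f)) mean) (trans (cancel (toℚ (Fm 2 f)) _)
      (trans (cong (λ t → toℚ t ÷ℕ (p ^ 2)) off-diagonal-value) (÷-p² T))))) (∣/∣ T (p₀ ℕ.+ p₀ ℕ.* p))
    right : (toℚ (Fm 2 f * (+ nnz f - + 1)) ÷ℕ (p ^ 2)) ≡ (F₂ * (ν - 1ℤ)) ℚ./ (p ℕ.* p)
    right = trans (÷-p² (Fm 2 f * (+ nnz f - + 1))) (cong (λ a → (a * (ν - 1ℤ)) ℚ./ (p ℕ.* p)) (Fm-2 f))

  V : ℤ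
  V = + 4 * α * W + + 2 * β * A

  p⁴ : ℕ
  p⁴ = p ℕ.* p ℕ.* p ℕ.* p

  p⁴-value : + p⁴ ≡ P * P * P * P
  p⁴-value = trans (ℤ.pos-* (p ℕ.* p ℕ.* p) p) (cong (_* P) (trans (ℤ.pos-* (p ℕ.* p) p) (cong (_* P) (ℤ.pos-* p p))))

  variance : Var (λ k → toℚ (X (H k) f)) ≡ V ℚ./ p⁴
  variance = trans (Var-toℚ (λ k → X (H k) f)) (/-cross {Σ Dev} {V} {suc M ℕ.* suc M ℕ.* suc M} {p⁴} cross)
    where
    open ≡-Reasoning
    s Q : ℤ
    s = Σ Y
    Q = Σ λ k → Y k * Y k
    Dev : Fin (suc M) → ℤ
    Dev k = (X (H k) f * + suc M - Σ (λ k → X (H k) f)) * (X (H k) f * + suc M - Σ (λ k → X (H k) f))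
    -- The constant `F₂` shifts value and mean alike, so the deviations depend on `Y` only.
    shift : ∀ a y n s → ((a + y) * n - (n * a + s)) * ((a + y) * n - (n * a + s)) ≡ n * n * (y * y) + - (+ 2 * n * s) * y + s * s
    shift = solve-∀
    collect : ∀ n s q → n * n * q + - (+ 2 * n * s) * s + n * (s * s) ≡ n * (n * q - s * s)
    collect = solve-∀
    total : Σ Dev ≡ N * (N * Q - s * s)
    total = begin
      Σ Dev
        ≡⟨ Σ-cong (λ k → trans (cong₂ (λ x t → (x * N - t) * (x * N - t)) (X-value k) X-sum) (shift F₂ (Y k) N s)) ⟩
      Σ (λ k → N * N * (Y k * Y k) + - (+ 2 * N * s) * Y k + s * s)
        ≡⟨ trans (Σ-+ {suc M} _ (λ _ → s * s)) (cong₂ _+_ (Σ-lin (N * N) (- (+ 2 * N * s)) (λ k → Y k * Y k) Y) (Σ-const (suc M) (s * s))) ⟩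
      N * N * Q + - (+ 2 * N * s) * s + N * (s * s)
        ≡⟨ collect N s Q ⟩
      N * (N * Q - s * s) ∎
    exchange : ∀ n e q → n * e * q ≡ n * (q * e)
    exchange = solve-∀
    cube : ∀ n v → n * (n * n * v) ≡ v * (n * n * n)
    cube = solve-∀
    cross : Σ Dev * + p⁴ ≡ V * + (suc M ℕ.* suc M ℕ.* suc M)
    cross = begin
      Σ Dev * + p⁴                                     ≡⟨ cong₂ _*_ total p⁴-value ⟩
      N * (N * Q - s * s) * (P * P * P * P)            ≡⟨ exchange N (N * Q - s * s) (P * P * P * P) ⟩
      N * (P * P * P * P * (N * Q - s * s))            ≡⟨ cong (N *_) scaled-variance ⟩
      N * (N * N * V)                                  ≡⟨ cube N V ⟩
      V * (N * N * N)                                  ≡⟨ cong (V *_) (trans (ℤ.pos-* (suc M ℕ.* suc M) (suc M)) (cong (_* N) (ℤ.pos-* (suc M) (suc M)))) ⟨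
      V * + (suc M ℕ.* suc M ℕ.* suc M)                ∎

  module _ (2u≤q : u ℕ.+ u ≤ suc p) (r≤q : suc r′ ≤ suc p) (support>0 : 0 < nnz f) where

    R′ q′ : ℤ
    R′ = + suc r′
    q′ = 1ℤ + P

    -- Strictness rests on this: for `f = 0` both the variance and its bound vanish.
    F₂>0 : 0ℤ ℤ.< F₂
    F₂>0 = ℤ.<-≤-trans (ℤ.+<+ support>0) n≤F₂

    from-≤ : ∀ {a b} → a ≤ b → 0ℤ ℤ.≤ + b - + a
    from-≤ a≤b = ℤ.i≤j⇒0≤j-i (ℤ.+≤+ a≤b)

    double : + (u ℕ.+ u) ≡ + 2 * + u
    double = trans (ℤ.pos-+ u u) (e (+ u))
      where e : ∀ a → a + a ≡ + 2 * a
            e = solve-∀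

    open Bound (+ u) P R′ (occupancy 0) S A W (F₂ * F₂)
      (from-≤ (ℕ.≤-trans (ℕ.s≤s (ℕ.s≤s ℕ.z≤n)) 4≤u))
      (subst (λ d → 0ℤ ℤ.≤ 1ℤ + P - d) double (from-≤ 2u≤q))
      (from-≤ (ℕ.s≤s {0} {r′} ℕ.z≤n)) (from-≤ r≤q) occupancy-0-positive occupancy-0-large collision-bound
      A-nonneg (*-pos F₂>0 F₂>0) W-bound A-bound
      using (variance-bound)

    numerator : ℤ
    numerator = + 2 * (q′ * q′ + R′ * R′) * (F₂ * F₂)

    -- The numerical estimate has the path sum in evaluated form, `2 n₀ - 1`; it is transported back
    -- to the sum over the kernel that defines `V`.
    V-bound : V * (q′ * q′ * R′) ℤ.< numerator * (P * P * P * P)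
    V-bound = subst (λ c → (+ 4 * (c * P - 1ℤ) * W + + 2 * (S * (P * P) - + 2 * c * P + 1ℤ) * A) * (q′ * q′ * R′) ℤ.< numerator * (P * P * P * P))
      (sym path-value) variance-bound

    q : ℕ
    q = suc p

    bound-value : (((+ 2 ℚ./ 1) ℚ.* (ℚ.1ℚ ℚ.+ ((+ suc r′ ℚ./ 1) ÷ℕ q) ℚ.* ((+ suc r′ ℚ./ 1) ÷ℕ q))
        ℚ.* toℚ (Fm 2 f * Fm 2 f)) ÷ℕ suc r′) ≡ numerator ℚ./ (q ℕ.* q ℕ.* suc r′)
    bound-value = begin
      (((+ 2 ℚ./ 1) ℚ.* (ℚ.1ℚ ℚ.+ ((+ suc r′ ℚ./ 1) ÷ℕ q) ℚ.* ((+ suc r′ ℚ./ 1) ÷ℕ q)) ℚ.* toℚ (Fm 2 f * Fm 2 f)) ÷ℕ suc r′)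
        ≡⟨ cong₂ (λ e g → (((+ 2 ℚ./ 1) ℚ.* (ℚ.1ℚ ℚ.+ e) ℚ.* toℚ g) ÷ℕ suc r′))
             (trans (cong (λ e → e ℚ.* e) (toℚ-÷ R′ q)) (/-* R′ R′ p p)) (cong₂ _*_ (Fm-2 f) (Fm-2 f)) ⟩
      (((+ 2 ℚ./ 1) ℚ.* (toℚ 1ℤ ℚ.+ (R′ * R′) ℚ./ (q ℕ.* q)) ℚ.* toℚ (F₂ * F₂)) ÷ℕ suc r′)
        ≡⟨ cong (λ e → ((toℚ (+ 2) ℚ.* e ℚ.* toℚ (F₂ * F₂)) ÷ℕ suc r′)) (toℚ-+ 1ℤ (R′ * R′) (p ℕ.+ p ℕ.* q)) ⟩
      ((toℚ (+ 2) ℚ.* ((1ℤ * + (q ℕ.* q) + R′ * R′) ℚ./ (q ℕ.* q)) ℚ.* toℚ (F₂ * F₂)) ÷ℕ suc r′)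
        ≡⟨ cong (_÷ℕ suc r′) (trans (cong (ℚ._* toℚ (F₂ * F₂)) (toℚ-* (+ 2) (1ℤ * + (q ℕ.* q) + R′ * R′) (p ℕ.+ p ℕ.* q)))
             (*-toℚ (F₂ * F₂) (+ 2 * (1ℤ * + (q ℕ.* q) + R′ * R′)) (p ℕ.+ p ℕ.* q))) ⟩
      ((+ 2 * (1ℤ * + (q ℕ.* q) + R′ * R′) * (F₂ * F₂)) ℚ./ (q ℕ.* q)) ÷ℕ suc r′
        ≡⟨ /-÷ (+ 2 * (1ℤ * + (q ℕ.* q) + R′ * R′) * (F₂ * F₂)) (p ℕ.+ p ℕ.* q) r′ ⟩
      (+ 2 * (1ℤ * + (q ℕ.* q) + R′ * R′) * (F₂ * F₂)) ℚ./ (q ℕ.* q ℕ.* suc r′)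
        ≡⟨ cong (λ z → (+ 2 * (z + R′ * R′) * (F₂ * F₂)) ℚ./ (q ℕ.* q ℕ.* suc r′)) (trans (ℤ.*-identityˡ (+ (q ℕ.* q))) (ℤ.pos-* q q)) ⟩
      numerator ℚ./ (q ℕ.* q ℕ.* suc r′) ∎
      where open ≡-Reasoning

    variance-upper : Var (λ k → toℚ (X (H k) f)) ℚ.<
      (((+ 2 ℚ./ 1) ℚ.* (ℚ.1ℚ ℚ.+ ((+ suc r′ ℚ./ 1) ÷ℕ q) ℚ.* ((+ suc r′ ℚ./ 1) ÷ℕ q)) ℚ.* toℚ (Fm 2 f * Fm 2 f)) ÷ℕ suc r′)
    variance-upper = subst₂ ℚ._<_ (sym variance) (sym bound-value) (/-cross-< {V} {numerator} {p⁴} {q ℕ.* q ℕ.* suc r′}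
      (subst₂ (λ d e → V * d ℤ.< numerator * e) (sym (trans (ℤ.pos-* (q ℕ.* q) (suc r′)) (cong (_* R′) (ℤ.pos-* q q)))) (sym p⁴-value) V-bound))

-- From powers of two to the arithmetic hypotheses

count-sketch : ∀ (u b r p M : ℕ) → 1 < r → r ≤ u / 2 → u ℕ.+ u ≤ 2 ^ b → suc p ≡ 2 ^ b → 2 ^ b ≡ 2 ^ (b ∸ 1) ℕ.+ 2 ^ (b ∸ 1) →
    (H : Family M u p) → FourUniversal H → (f : Fin u → ℤ) →
    let open CountSketch b r
        EX = 𝔼 (λ k → toℚ (X (H k) f))
    in (EX ≡ toℚ (Fm 2 f) ℚ.+ (toℚ (Fm 1 f * Fm 1 f - Fm 2 f) ÷ℕ (p ^ 2)))
       × (ℚ.∣ EX ℚ.- toℚ (Fm 2 f) ∣ ℚ.≤ (toℚ (Fm 2 f * (+ nnz f - + 1)) ÷ℕ (p ^ 2)))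
       × (0 < nnz f → Var (λ k → toℚ (X (H k) f)) ℚ.<
          (((+ 2 ℚ./ 1) ℚ.* (ℚ.1ℚ ℚ.+ ((+ r ℚ./ 1) ÷ℕ (2 ^ b)) ℚ.* ((+ r ℚ./ 1) ÷ℕ (2 ^ b))) ℚ.* toℚ (Fm 2 f * Fm 2 f)) ÷ℕ r))
count-sketch u b (suc r′) (suc p₀) M 1<r r≤u/2 2u≤q p+1≡q q≡2Q H univ f = mean , bias , λ support>0 →
    subst (λ q → Var (λ k → toℚ (X (H k) f)) ℚ.<
      (((+ 2 ℚ./ 1) ℚ.* (ℚ.1ℚ ℚ.+ ((+ suc r′ ℚ./ 1) ÷ℕ q) ℚ.* ((+ suc r′ ℚ./ 1) ÷ℕ q)) ℚ.* toℚ (Fm 2 f * Fm 2 f)) ÷ℕ suc r′))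
      p+1≡q (variance-upper (subst (u ℕ.+ u ≤_) (sym p+1≡q) 2u≤q)
        (subst (suc r′ ≤_) (sym p+1≡q) (ℕ.≤-trans (ℕ.≤-trans r≤u/2 (ℕ.m/n≤m u 2)) (ℕ.≤-trans (ℕ.m≤m+n u u) 2u≤q))) support>0)
  where
  open CountSketch b (suc r′) using (X)
  4≤u : 4 ≤ u
  -- The chain is `4 ≤ 2 r ≤ 2 ⌊u/2⌋ ≤ u`.
  4≤u = ℕ.≤-trans (ℕ.*-monoˡ-≤ 2 1<r) (ℕ.≤-trans (ℕ.*-monoˡ-≤ 2 r≤u/2) (ℕ.m/n*n≤m u 2))
  open Estimate b r′ M u p₀ (trans p+1≡q q≡2Q) 4≤u H univ f
-- `p = 0` would make 1 a sum of two equal naturals.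
count-sketch u b r zero M 1<r r≤u/2 2u≤q p+1≡q q≡2Q = ⊥-elim (odd (2 ^ (b ∸ 1)) (trans p+1≡q q≡2Q))
  where
  odd : ∀ h → 1 ≡ h ℕ.+ h → ⊥
  odd (suc h) e = ℕ.0≢1+n (trans (ℕ.suc-injective e) (ℕ.+-suc h h))

theorem8 : (w b r M : ℕ) →
    1 < r → r ≤ (2 ^ w) / 2 →
    Prime (2 ^ b ∸ 1) → 2 ^ w < 2 ^ b ∸ 1 →
    (H : Family M (2 ^ w) (2 ^ b ∸ 1)) → FourUniversal H →
    (f : Fin (2 ^ w) → ℤ) →
    let open CountSketch b r
        p = 2 ^ b ∸ 1
        F1 = Fm 1 f
        F2 = Fm 2 f
        EX = 𝔼 (λ k → toℚ (X (H k) f))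
        VX = Var (λ k → toℚ (X (H k) f))
    in (EX ≡ toℚ F2 ℚ.+ (toℚ (F1 ℤ.* F1 ℤ.- F2) ÷ℕ (p ^ 2)))
       × (ℚ.∣ EX ℚ.- toℚ F2 ∣ ℚ.≤ (toℚ (F2 ℤ.* (+ nnz f ℤ.- + 1)) ÷ℕ (p ^ 2)))
       × (0 < nnz f →
          VX ℚ.< (((+ 2 ℚ./ 1) ℚ.* (ℚ.1ℚ ℚ.+ ((+ r ℚ./ 1) ÷ℕ (2 ^ b)) ℚ.* ((+ r ℚ./ 1) ÷ℕ (2 ^ b)))
                   ℚ.* toℚ (F2 ℤ.* F2)) ÷ℕ r))
-- For `b = 0` the modulus is 0 and cannot exceed `u`.
theorem8 w zero    r M 1<r r≤u/2 _ ()
theorem8 w (suc b) r M 1<r r≤u/2 _ u<p H univ f =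
  count-sketch (2 ^ w) (suc b) r (2 ^ suc b ∸ 1) M 1<r r≤u/2 2u≤q
    (trans (ℕ.+-comm 1 (2 ^ suc b ∸ 1)) (ℕ.m∸n+n≡m (ℕ.m^n>0 2 (suc b)))) q≡2Q H univ f
  where
  q≡2Q : 2 ^ suc b ≡ 2 ^ b ℕ.+ 2 ^ b
  q≡2Q = cong (2 ^ b ℕ.+_) (ℕ.+-identityʳ (2 ^ b))
  -- Both `u` and the range are powers of two, so `u` below `2^(b+1)` is already at most `2^b`. This
  -- yields the factor 2 in `2 u ≤ q` on which the positivity of `Z` depends.
  w≤b : w ≤ b
  w≤b = ℕ.≮⇒≥ λ b<w → ℕ.<⇒≱ u<p (ℕ.≤-trans (ℕ.m∸n≤m (2 ^ suc b) 1) (ℕ.^-monoʳ-≤ 2 b<w))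
  2u≤q : 2 ^ w ℕ.+ 2 ^ w ≤ 2 ^ suc b
  2u≤q = subst (2 ^ w ℕ.+ 2 ^ w ≤_) (sym q≡2Q) (ℕ.+-mono-≤ (ℕ.^-monoʳ-≤ 2 w≤b) (ℕ.^-monoʳ-≤ 2 w≤b))
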